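{- Let $M$ be a combinatorial $3$-manifold with vertex set $V=V_1\dot\cup V_2$, and let $S_{(V_1,V_2)}$ be a connected slicing of $M$ of genus $g$ with $q$ quadrilaterals. Suppose that for some $i\in\{1,2\}$ the induced subcomplex $\operatorname{span}(V_i)$ has dimension $1$, and let $n:=|V_i|$. Then \[ q\ \ge\ 3(n+g-1). \] In particular, this applies to every slicing all of whose facets are quadrilaterals.
   Context: A combinatorial $3$-manifold is a finite pure $3$-dimensional simplicial complex in which the link of every vertex is a combinatorial $2$-sphere. For a set $W$ of vertices, $\operatorname{span}(W)$ is the induced subcomplex of $M$ on $W$ (all simplices of $M$ with all vertices in $W$). A function $f:M\to\mathbb{R}$ is regular simplexwise linear (rsl) if it is linear on every simplex and takes pairwise distinct values on the vertices. Given a partition $V=V_1\dot\cup V_2$ of the vertex set into nonempty sets, choose an rsl-function $f$ with $f(v)<f(w)$ for all $v\in V_1$, $w\in V_2$ and $x_0$ strictly between $\max f(V_1)$ and $\min f(V_2)$; the slicing $S_{(V_1,V_2)}$ is the polyhedral surface $f^{ -1}(x_0)$, whose facets are the triangles and quadrilaterals obtained by intersecting $f^{ -1}(x_0)$ with the tetrahedra of $M$ meeting both $V_1$ and $V_2$ (a quadrilateral arises from a tetrahedron with exactly two vertices in each part).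
   Formalization: In the "in particular" clause M is assumed connected; otherwise it fails: adding one extra component inside V₁ and another inside V₂ leaves a connected all-quadrilateral slicing unchanged while both spans become 3-dimensional. The inequality itself needs no such assumption. -}

module Defs where

open import Data.Empty using (⊥-elim)
open import Data.Fin.Base using (Fin; zero; suc)
import Data.Fin.Properties as Fin
open import Data.Fin.Subset
open import Data.Fin.Subset.Properties
open import Data.Integer.Base as ℤ using (ℤ; +_)
open import Data.List.Base as List using (List; []; _∷_; _++_; length; filter)
open import Data.Nat.Base using (ℕ; zero; suc; _+_; _*_; _≤_)
import Data.Nat.Properties as ℕ
open import Data.Product.Base using (∃; ∃-syntax; _×_; _,_)
import Data.Sum.Base as Sum
open import Data.Vec.Base using ([]; _∷_; here; tabulate)
open import Function.Base using (_∘_; id)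
open import Level using (0ℓ)
open import Relation.Binary.Construct.Closure.Equivalence using (EqClosure)
open import Relation.Binary.Construct.Closure.ReflexiveTransitive using (Star)
open import Relation.Binary.PropositionalEquality using (_≡_)
open import Relation.Nullary.Decidable using (does; ¬?; _×-dec_)
open import Relation.Unary using (Pred; Decidable)

private
  variable
    m n : ℕ

-- Finite abstract simplicial complexes with labels in Fin n.  The empty
-- simplex always belongs to the complex.  A label need not be a vertex: v is
-- a vertex only when ⁅ v ⁆ is a face, so links and induced subcomplexes can
-- keep the labels of the ambient complex.

record Complex (n : ℕ) : Set₁ where
  field
    Face        : Pred (Subset n) 0ℓ
    face?       : Decidable Face
    empty-face  : Face ⊥
    down-closed : ∀ {σ τ} → τ ⊆ σ → Face σ → Face τ

open Complex public

Vertex : Complex n → Fin n → Set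
Vertex K v = Face K ⁅ v ⁆

vertices : Complex n → Subset n
vertices K = tabulate λ v → does (face? K ⁅ v ⁆)

HasDimension : Complex n → ℕ → Set
HasDimension K d =
  (∃[ σ ] Face K σ × ∣ σ ∣ ≡ suc d) ×
  (∀ σ → Face K σ → ∣ σ ∣ ≤ suc d)

IsPure : Complex n → ℕ → Set
IsPure K d =
  HasDimension K d ×
  (∀ σ → Face K σ → ∃[ τ ] Face K τ × ∣ τ ∣ ≡ suc d × σ ⊆ τ)

-- For a simplicial complex, connectedness is connectedness of the 1-skeleton.

IsConnected : Complex n → Set
IsConnected K =
  ∃ (Vertex K) ×
  (∀ {v w} → Vertex K v → Vertex K w →
    Star (λ x y → Face K (⁅ x ⁆ ∪ ⁅ y ⁆)) v w)

span : Subset n → Complex n → Complex n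
span W K = record
  { Face        = λ τ → Face K τ × τ ⊆ W
  ; face?       = λ τ → face? K τ ×-dec (τ ⊆? W)
  ; empty-face  = empty-face K , ⊆-min W
  ; down-closed = λ τ⊆σ (σ∈K , σ⊆W) → down-closed K τ⊆σ σ∈K , σ⊆W ∘ τ⊆σ
  }

∪-monoʳ-⊆ : ∀ (ρ : Subset n) {σ τ} → τ ⊆ σ → ρ ∪ τ ⊆ ρ ∪ σ
∪-monoʳ-⊆ ρ {_} {τ} τ⊆σ = x∈p∪q⁺ ∘ Sum.map id τ⊆σ ∘ x∈p∪q⁻ ρ τ

link : (K : Complex n) (v : Fin n) → Vertex K v → Complex n
link K v v∈K = record
  { Face        = λ τ → v ∉ τ × Face K (⁅ v ⁆ ∪ τ)
  ; face?       = λ τ → ¬? (v ∈? τ) ×-dec face? K (⁅ v ⁆ ∪ τ)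
  ; empty-face  = ∉⊥ , down-closed K (∪⊥⊆ ⁅ v ⁆) v∈K
  ; down-closed = λ τ⊆σ (v∉σ , vσ∈K) →
      v∉σ ∘ τ⊆σ , down-closed K (∪-monoʳ-⊆ ⁅ v ⁆ τ⊆σ) vσ∈K
  }
  where
  ∪⊥⊆ : ∀ {n} (ρ : Subset n) → ρ ∪ ⊥ ⊆ ρ
  ∪⊥⊆ ρ = Sum.[ id , ⊥-elim ∘ ∉⊥ ]′ ∘ x∈p∪q⁻ ρ ⊥

∂Δ : ∀ d → Complex (suc d)
∂Δ d = record
  { Face        = _⊂ ⊤
  ; face?       = _⊂? ⊤
  ; empty-face  = ⊆-min ⊤ , zero , ∈⊤ , ∉⊥
  ; down-closed = ⊆-⊂-trans
  }

-- The stellar subdivision of K at a nonempty face σ, with new vertex a: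
-- the open star of σ is removed and replaced by the cone a * ∂σ * lk σ.  The
-- label zero is the new vertex a, and the old labels are shifted by one.  A
-- simplex a * τ belongs to the cone iff σ ∪ τ is a face and σ ⊈ τ.

StellarFace : (K : Complex n) → Subset n → Pred (Subset (suc n)) 0ℓ
StellarFace K σ (outside ∷ τ) = Face K τ × σ ⊈ τ
StellarFace K σ (inside  ∷ τ) = Face K (σ ∪ τ) × σ ⊈ τ

stellar : (K : Complex n) (σ : Subset n) → Nonempty σ → Face K σ →
          Complex (suc n)
stellar {n} K σ (x , x∈σ) _ = record
  { Face        = StellarFace K σ
  ; face?       = dec
  ; empty-face  = empty-face K , λ σ⊆⊥ → ∉⊥ (σ⊆⊥ x∈σ)
  ; down-closed = λ {ρ} {τ} → closed ρ τ
  }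
  where
  dec : Decidable (StellarFace K σ)
  dec (outside ∷ τ) = face? K τ ×-dec ¬? (σ ⊆? τ)
  dec (inside  ∷ τ) = face? K (σ ∪ τ) ×-dec ¬? (σ ⊆? τ)

  ⊈-⊆ : ∀ {ρ τ : Subset n} → τ ⊆ ρ → σ ⊈ ρ → σ ⊈ τ
  ⊈-⊆ τ⊆ρ σ⊈ρ σ⊆τ = σ⊈ρ λ y∈σ → τ⊆ρ (σ⊆τ y∈σ)

  closed : ∀ ρ τ → τ ⊆ ρ → StellarFace K σ ρ → StellarFace K σ τ
  closed (outside ∷ ρ) (outside ∷ τ) τ⊆ρ (ρ∈K , σ⊈ρ) =
    down-closed K (drop-∷-⊆ τ⊆ρ) ρ∈K , ⊈-⊆ (drop-∷-⊆ τ⊆ρ) σ⊈ρ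
  closed (inside ∷ ρ) (outside ∷ τ) τ⊆ρ (σρ∈K , σ⊈ρ) =
    down-closed K (λ y∈τ → q⊆p∪q σ ρ (drop-∷-⊆ τ⊆ρ y∈τ)) σρ∈K ,
    ⊈-⊆ (drop-∷-⊆ τ⊆ρ) σ⊈ρ
  closed (inside ∷ ρ) (inside ∷ τ) τ⊆ρ (σρ∈K , σ⊈ρ) =
    down-closed K (∪-monoʳ-⊆ σ (drop-∷-⊆ τ⊆ρ)) σρ∈K ,
    ⊈-⊆ (drop-∷-⊆ τ⊆ρ) σ⊈ρ
  closed (outside ∷ ρ) (inside ∷ τ) τ⊆ρ with () ← τ⊆ρ {zero} here

image : (Fin m → Fin n) → Subset m → Subset n
image f σ = tabulate λ j → does (Fin.any? λ i → (i ∈? σ) ×-dec (f i Fin.≟ j))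

-- Simplicial isomorphism.  The two vertex maps are constrained only on actual
-- vertices, so labels that are not vertices play no role.

record _≅_ (K : Complex m) (L : Complex n) : Set where
  field
    to        : Fin m → Fin n
    from      : Fin n → Fin m
    to-face   : ∀ {σ} → Face K σ → Face L (image to σ)
    from-face : ∀ {σ} → Face L σ → Face K (image from σ)
    from∘to   : ∀ {v} → Vertex K v → from (to v) ≡ v
    to∘from   : ∀ {w} → Vertex L w → to (from w) ≡ w

-- Piecewise linear homeomorphism of finite complexes in Alexander's
-- combinatorial form: a finite chain of stellar subdivisions, inverses of
-- stellar subdivisions, and isomorphisms.

data StellarMove : ∃ Complex → ∃ Complex → Set₁ where
  relabel   : {K : Complex m} {L : Complex n} → K ≅ L →
              StellarMove (m , K) (n , L)
  subdivide : (K : Complex n) (σ : Subset n) (ne : Nonempty σ) (σ∈K : Face K σ) →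
              StellarMove (n , K) (suc n , stellar K σ ne σ∈K)

_≈PL_ : Complex m → Complex n → Set₁
_≈PL_ {m} {n} K L = EqClosure StellarMove (m , K) (n , L)

IsCombinatorialSphere : ℕ → Complex n → Set₁
IsCombinatorialSphere d K = K ≈PL ∂Δ (suc d)

record IsCombinatorial3Manifold (M : Complex n) : Set₁ where
  field
    pure        : IsPure M 3
    link-sphere : ∀ v (v∈M : Vertex M v) → IsCombinatorialSphere 2 (link M v v∈M)

IsPartition : Complex n → (Fin 2 → Subset n) → Set
IsPartition M V =
  V zero ∪ V (suc zero) ≡ vertices M ×
  V zero ∩ V (suc zero) ≡ ⊥ ×
  Nonempty (V zero) × Nonempty (V (suc zero))

subsets : ∀ n → List (Subset n)
subsets zero    = [] ∷ []
subsets (suc n) = List.map (inside ∷_) (subsets n) ++ List.map (outside ∷_) (subsets n)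

♯ : {P : Pred (Subset n) 0ℓ} → Decidable P → ℕ
♯ {n} P? = length (filter P? (subsets n))

-- The slicing f⁻¹(x₀) defined by the partition V.  Its k-cells are the
-- nonempty sets σ ∩ f⁻¹(x₀) with σ a (k+1)-simplex of M; since x₀ is not a
-- vertex value and separates f(V zero) from f(V (suc zero)), the intersection
-- is nonempty exactly when σ meets both parts.  A cell is represented by its
-- simplex σ, and the face relation between cells is inclusion of simplices.

module Slicing (M : Complex n) (V : Fin 2 → Subset n) where

  Cell : ℕ → Subset n → Set
  Cell k σ =
    Face M σ × ∣ σ ∣ ≡ 2 + k ×
    Nonempty (σ ∩ V zero) × Nonempty (σ ∩ V (suc zero))

  cell? : ∀ k → Decidable (Cell k)
  cell? k σ =
    face? M σ ×-dec (∣ σ ∣ ℕ.≟ 2 + k) ×-dec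
    nonempty? (σ ∩ V zero) ×-dec nonempty? (σ ∩ V (suc zero))

  Quadrilateral : Subset n → Set
  Quadrilateral σ =
    Cell 2 σ × ∣ σ ∩ V zero ∣ ≡ 2 × ∣ σ ∩ V (suc zero) ∣ ≡ 2

  quadrilateral? : Decidable Quadrilateral
  quadrilateral? σ =
    cell? 2 σ ×-dec (∣ σ ∩ V zero ∣ ℕ.≟ 2) ×-dec (∣ σ ∩ V (suc zero) ∣ ℕ.≟ 2)

  Adjacent : Subset n → Subset n → Set
  Adjacent σ τ = Cell 0 σ × Cell 0 τ × (∃[ ε ] Cell 1 ε × σ ⊆ ε × τ ⊆ ε)

  Connected : Set
  Connected =
    ∃ (Cell 0) × (∀ {σ τ} → Cell 0 σ → Cell 0 τ → Star Adjacent σ τ)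

  χ : ℤ
  χ = + ♯ (cell? 0) ℤ.- + ♯ (cell? 1) ℤ.+ + ♯ (cell? 2)

  -- The genus of a connected closed surface, normalised by χ = 2 - 2g.  For an
  -- orientable surface g is the number of handles; a nonorientable surface is
  -- also allowed, with g half its number of crosscaps.

  HasGenus : ℕ → Set
  HasGenus g = χ ≡ + 2 ℤ.- + (2 * g)

  quadrilaterals : ℕ
  quadrilaterals = ♯ quadrilateral?

  AllQuadrilaterals : Set
  AllQuadrilaterals = ∀ {σ} → Cell 2 σ → Quadrilateral σ

{-# OPTIONS --safe #-}

-- For a face σ of a triangulated sphere, the sum of (-1)^∣τ∣ over the faces τ
-- containing σ does not depend on σ.  This property passes through stellar
-- moves in both directions, so it holds for the vertex links of M, and
-- therefore the corresponding sum in M is 1 for every nonempty face.  Summing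
-- it with signs over the nonempty faces in W = V i and exchanging the two
-- summations gives χ(S) = 2 χ(span W).  If span W is a graph with n vertices
-- and e edges, then 2 - 2g = 2(n - e).  Each of the e = n + g - 1 edges lies
-- in at least three tetrahedra, all of which meet W exactly in that edge and
-- hence are quadrilaterals of S, and no quadrilateral is obtained twice.
--
-- If all facets of S are quadrilaterals, a tetrahedron adjacent to one inside
-- W shares three vertices with W and so lies inside W.  Since the facets of
-- every vertex link are connected through ridges (again a stellar invariant),
-- one triangle in W would force the vertices of the connected complex M into
-- W; so span W has dimension 1.

module Submission where

open import Defs
open import Data.Bool.Base using (if_then_else_; not)
import Data.Bool.Properties as Bool
open import Data.Fin.Base using (Fin; zero; suc; opposite)
import Data.Fin.Properties as Fin
open import Data.Fin.Subset
open import Data.Fin.Subset.Properties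
open import Data.Integer.Base as ℤ using (ℤ; +_; 0ℤ; 1ℤ; -1ℤ; +≤+)
import Data.Integer.Properties as ℤ
open import Data.Integer.Tactic.RingSolver using (solve-∀)
open import Data.List.Base as List using ([]; _∷_; length; filter)
import Data.List.Properties as List
open import Data.Nat.Base using (ℕ; zero; suc; _+_; _*_; _∸_; _≤_; _≥_; s≤s; z≤n)
import Data.Nat.Properties as ℕ
open import Data.Product.Base using (∃-syntax; _×_; _,_; proj₁; proj₂)
open import Data.Sum.Base using (_⊎_; inj₁; inj₂; [_,_]′)
open import Data.Vec.Base using ([]; _∷_; here; there; updateAt)
import Data.Vec.Properties as Vec
open import Function.Base using (_∘_; id; case_of_)
open import Level using (0ℓ)
open import Relation.Binary.Construct.Closure.ReflexiveTransitive
  using (Star; ε; _◅_; _◅◅_; gmap)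
open import Relation.Binary.Construct.Closure.Symmetric using (fwd; bwd)
open import Relation.Binary.PropositionalEquality
open import Relation.Nullary.Decidable
  using (Dec; yes; no; does; ¬?; _×-dec_; from-no; decidable-stable; dec-true)
open import Relation.Nullary.Negation using (¬_; contradiction)
open import Relation.Unary using (Pred; Decidable)

private
  variable
    m n d : ℕ
    A B : Set
    P Q : Pred (Subset n) 0ℓ

-- Sums over all subsets

infix 4 _≟ˢ_

_≟ˢ_ : (σ τ : Subset n) → Dec (σ ≡ τ)
_≟ˢ_ = Vec.≡-dec Bool._≟_

infixr 5 _▸_

-- An Iverson bracket. Restricted sums become sums over all subsets, so two summations can be
-- exchanged without adjusting their index sets.
_▸_ : Dec A → ℤ → ℤ
a? ▸ z = if does a? then z else 0ℤ

▸-yes : (a? : Dec A) {z : ℤ} → A → a? ▸ z ≡ z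
▸-yes (yes _) _ = refl
▸-yes (no ¬a) a = contradiction a ¬a

▸-no : (a? : Dec A) {z : ℤ} → ¬ A → a? ▸ z ≡ 0ℤ
▸-no (yes a) ¬a = contradiction a ¬a
▸-no (no _)  _  = refl

▸-cong : (a? : Dec A) (b? : Dec B) {w z : ℤ} →
         (A → B) → (B → A) → (A → w ≡ z) → a? ▸ w ≡ b? ▸ z
▸-cong (yes a) b? f g eq = trans (eq a) (sym (▸-yes b? (f a)))
▸-cong (no ¬a) b? f g eq = sym (▸-no b? (¬a ∘ g))

▸-neg : (a? : Dec A) (z : ℤ) → a? ▸ ℤ.- z ≡ ℤ.- (a? ▸ z)
▸-neg (yes _) z = refl
▸-neg (no _)  z = refl

▸-split : (a? : Dec A) (b? : Dec B) (z : ℤ) →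
          a? ▸ z ≡ ((a? ×-dec b?) ▸ z) ℤ.+ ((a? ×-dec ¬? b?) ▸ z)
▸-split (no _)  b?      z = refl
▸-split (yes _) (yes _) z = sym (ℤ.+-identityʳ z)
▸-split (yes _) (no _)  z = sym (ℤ.+-identityˡ z)

Σˢ : (Subset n → ℤ) → ℤ
Σˢ {zero}  f = f []
Σˢ {suc n} f = Σˢ (f ∘ (inside ∷_)) ℤ.+ Σˢ (f ∘ (outside ∷_))

Σˢ-cong : {f g : Subset n → ℤ} → (∀ σ → f σ ≡ g σ) → Σˢ f ≡ Σˢ g
Σˢ-cong {zero}  eq = eq []
Σˢ-cong {suc n} eq = cong₂ ℤ._+_ (Σˢ-cong (eq ∘ (inside ∷_))) (Σˢ-cong (eq ∘ (outside ∷_)))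

Σˢ-mono : {f g : Subset n → ℤ} → (∀ σ → f σ ℤ.≤ g σ) → Σˢ f ℤ.≤ Σˢ g
Σˢ-mono {zero}  le = le []
Σˢ-mono {suc n} le = ℤ.+-mono-≤ (Σˢ-mono (le ∘ (inside ∷_))) (Σˢ-mono (le ∘ (outside ∷_)))

Σˢ-zero : {f : Subset n → ℤ} → (∀ σ → f σ ≡ 0ℤ) → Σˢ f ≡ 0ℤ
Σˢ-zero {zero}  eq = eq []
Σˢ-zero {suc n} eq = cong₂ ℤ._+_ (Σˢ-zero (eq ∘ (inside ∷_))) (Σˢ-zero (eq ∘ (outside ∷_)))

interchange : ∀ a b c d → (a ℤ.+ b) ℤ.+ (c ℤ.+ d) ≡ (a ℤ.+ c) ℤ.+ (b ℤ.+ d)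
interchange = solve-∀

Σˢ-+ : (f g : Subset n → ℤ) → Σˢ (λ σ → f σ ℤ.+ g σ) ≡ Σˢ f ℤ.+ Σˢ g
Σˢ-+ {zero}  f g = refl
Σˢ-+ {suc n} f g =
  trans (cong₂ ℤ._+_ (Σˢ-+ (f ∘ (inside ∷_)) (g ∘ (inside ∷_)))
                     (Σˢ-+ (f ∘ (outside ∷_)) (g ∘ (outside ∷_))))
        (interchange (Σˢ (f ∘ (inside ∷_))) (Σˢ (g ∘ (inside ∷_))) _ _)

Σˢ-*ˡ : (c : ℤ) (f : Subset n → ℤ) → Σˢ (λ σ → c ℤ.* f σ) ≡ c ℤ.* Σˢ f
Σˢ-*ˡ {zero}  c f = refl
Σˢ-*ˡ {suc n} c f =
  trans (cong₂ ℤ._+_ (Σˢ-*ˡ c (f ∘ (inside ∷_))) (Σˢ-*ˡ c (f ∘ (outside ∷_))))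
        (sym (ℤ.*-distribˡ-+ c _ _))

Σˢ-neg : (f : Subset n → ℤ) → Σˢ (λ σ → ℤ.- f σ) ≡ ℤ.- Σˢ f
Σˢ-neg {zero}  f = refl
Σˢ-neg {suc n} f =
  trans (cong₂ ℤ._+_ (Σˢ-neg (f ∘ (inside ∷_))) (Σˢ-neg (f ∘ (outside ∷_))))
        (sym (ℤ.neg-distrib-+ (Σˢ (f ∘ (inside ∷_))) _))

Σˢ-swap : (f : Subset m → Subset n → ℤ) →
          Σˢ (λ σ → Σˢ (f σ)) ≡ Σˢ (λ τ → Σˢ (λ σ → f σ τ))
Σˢ-swap {zero}  f = refl
Σˢ-swap {suc m} f =
  trans (cong₂ ℤ._+_ (Σˢ-swap (f ∘ (inside ∷_))) (Σˢ-swap (f ∘ (outside ∷_))))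
        (sym (Σˢ-+ (λ τ → Σˢ (λ σ → f (inside ∷ σ) τ)) _))

Σˢ-δ : (ρ : Subset n) (z : ℤ) → Σˢ (λ τ → (τ ≟ˢ ρ) ▸ z) ≡ z
Σˢ-δ {zero}  []            z = refl
Σˢ-δ {suc n} (inside ∷ ρ)  z =
  trans (cong₂ ℤ._+_
          (trans (Σˢ-cong λ τ → ▸-cong (inside ∷ τ ≟ˢ inside ∷ ρ) (τ ≟ˢ ρ)
                                  Vec.∷-injectiveʳ (cong (inside ∷_)) (λ _ → refl))
                 (Σˢ-δ ρ z))
          (Σˢ-zero λ τ → ▸-no (outside ∷ τ ≟ˢ inside ∷ ρ) {z} λ ()))
        (ℤ.+-identityʳ z)
Σˢ-δ {suc n} (outside ∷ ρ) z =
  trans (cong₂ ℤ._+_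
          (Σˢ-zero λ τ → ▸-no (inside ∷ τ ≟ˢ outside ∷ ρ) {z} λ ())
          (trans (Σˢ-cong λ τ → ▸-cong (outside ∷ τ ≟ˢ outside ∷ ρ) (τ ≟ˢ ρ)
                                  Vec.∷-injectiveʳ (cong (outside ∷_)) (λ _ → refl))
                 (Σˢ-δ ρ z)))
        (ℤ.+-identityˡ z)

-- Insert the indicator of `τ ≡ φ σ` and exchange the sums: the graph of `φ` over `P` is the graph
-- of `ψ` over `Q`. The maps have to be inverse only on `P` and `Q`, which suits isomorphisms
-- constrained only on actual faces.
Σˢ-bijection : (P? : Decidable P) (Q? : Decidable Q) (f : Subset m → ℤ) (g : Subset n → ℤ)
  (φ : Subset m → Subset n) (ψ : Subset n → Subset m) →
  (∀ {σ} → P σ → Q (φ σ)) → (∀ {τ} → Q τ → P (ψ τ)) →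
  (∀ {σ} → P σ → ψ (φ σ) ≡ σ) → (∀ {τ} → Q τ → φ (ψ τ) ≡ τ) →
  (∀ {σ} → P σ → f σ ≡ g (φ σ)) →
  Σˢ (λ σ → P? σ ▸ f σ) ≡ Σˢ (λ τ → Q? τ ▸ g τ)
Σˢ-bijection {P = P} {Q = Q} P? Q? f g φ ψ φ-P ψ-Q ψφ φψ f≡g = begin
  Σˢ (λ σ → P? σ ▸ f σ)
    ≡⟨ Σˢ-cong (λ σ → sym (Σˢ-δ (φ σ) _)) ⟩
  Σˢ (λ σ → Σˢ (λ τ → (τ ≟ˢ φ σ) ▸ P? σ ▸ f σ))
    ≡⟨ Σˢ-swap (λ σ τ → (τ ≟ˢ φ σ) ▸ P? σ ▸ f σ) ⟩
  Σˢ (λ τ → Σˢ (λ σ → (τ ≟ˢ φ σ) ▸ P? σ ▸ f σ))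
    ≡⟨ Σˢ-cong (λ τ → Σˢ-cong (λ σ → pointwise σ τ)) ⟩
  Σˢ (λ τ → Σˢ (λ σ → (σ ≟ˢ ψ τ) ▸ Q? τ ▸ g τ))
    ≡⟨ Σˢ-cong (λ τ → Σˢ-δ (ψ τ) _) ⟩
  Σˢ (λ τ → Q? τ ▸ g τ) ∎
  where
  open ≡-Reasoning
  nested : {z : ℤ} (a? : Dec A) (b? : Dec B) → a? ▸ b? ▸ z ≡ (a? ×-dec b?) ▸ z
  nested (yes _) b? = refl
  nested (no _)  b? = refl
  pointwise : ∀ σ τ → (τ ≟ˢ φ σ) ▸ P? σ ▸ f σ ≡ (σ ≟ˢ ψ τ) ▸ Q? τ ▸ g τ
  pointwise σ τ = begin
    (τ ≟ˢ φ σ) ▸ P? σ ▸ f σ          ≡⟨ nested (τ ≟ˢ φ σ) (P? σ) ⟩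
    ((τ ≟ˢ φ σ) ×-dec P? σ) ▸ f σ    ≡⟨ ▸-cong ((τ ≟ˢ φ σ) ×-dec P? σ) ((σ ≟ˢ ψ τ) ×-dec Q? τ)
      (λ { (refl , p) → sym (ψφ p) , φ-P p })
      (λ { (refl , q) → sym (φψ q) , ψ-Q q })
      (λ { (refl , p) → f≡g p }) ⟩
    ((σ ≟ˢ ψ τ) ×-dec Q? τ) ▸ g τ    ≡⟨ nested (σ ≟ˢ ψ τ) (Q? τ) ⟨
    (σ ≟ˢ ψ τ) ▸ Q? τ ▸ g τ          ∎

toggle : Fin n → Subset n → Subset n
toggle x σ = updateAt σ x not

-- Each subset containing `x` cancels against the same subset without `x`.
Σˢ-toggle : (x : Fin n) (f : Subset n → ℤ) → (∀ σ → f (toggle x σ) ≡ ℤ.- f σ) → Σˢ f ≡ 0ℤ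
Σˢ-toggle zero    f anti =
  trans (sym (Σˢ-+ (f ∘ (inside ∷_)) (f ∘ (outside ∷_))))
        (Σˢ-zero λ σ → trans (cong (ℤ._+ f (outside ∷ σ)) (anti (outside ∷ σ)))
                             (ℤ.+-inverseˡ (f (outside ∷ σ))))
Σˢ-toggle (suc x) f anti =
  cong₂ ℤ._+_ (Σˢ-toggle x (f ∘ (inside ∷_)) (anti ∘ (inside ∷_)))
              (Σˢ-toggle x (f ∘ (outside ∷_)) (anti ∘ (outside ∷_)))

-- Cardinalities and signed counts of families of subsets

card : Decidable P → ℤ
card P? = Σˢ λ σ → P? σ ▸ 1ℤ

♯≡card : (P? : Decidable P) → + ♯ P? ≡ card P?
♯≡card {zero} P? with P? []
... | yes _ = refl
... | no  _ = refl
♯≡card {suc n} P? = begin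
  + length (filter P? (List.map (inside ∷_) (subsets n) List.++ List.map (outside ∷_) (subsets n)))
    ≡⟨ cong (+_ ∘ length) (List.filter-++ P? (List.map (inside ∷_) (subsets n)) _) ⟩
  + length (filter P? (List.map (inside ∷_) (subsets n)) List.++
            filter P? (List.map (outside ∷_) (subsets n)))
    ≡⟨ cong +_ (List.length-++ (filter P? (List.map (inside ∷_) (subsets n)))) ⟩
  + (length (filter P? (List.map (inside ∷_) (subsets n))) +
     length (filter P? (List.map (outside ∷_) (subsets n))))
    ≡⟨ cong₂ (λ k l → + (k + l)) (filter-map inside (subsets n)) (filter-map outside (subsets n)) ⟩
  + (♯ (P? ∘ (inside ∷_)) + ♯ (P? ∘ (outside ∷_)))
    ≡⟨ cong₂ ℤ._+_ (♯≡card (P? ∘ (inside ∷_))) (♯≡card (P? ∘ (outside ∷_))) ⟩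
  card P? ∎
  where
  open ≡-Reasoning
  filter-map : ∀ s xs → length (filter P? (List.map (s ∷_) xs)) ≡ length (filter (P? ∘ (s ∷_)) xs)
  filter-map s []       = refl
  filter-map s (x ∷ xs) with does (P? (s ∷ x))
  ... | inside  = cong suc (filter-map s xs)
  ... | outside = filter-map s xs

sgn : Subset n → ℤ
sgn []            = 1ℤ
sgn (inside ∷ σ)  = ℤ.- sgn σ
sgn (outside ∷ σ) = sgn σ

sgn-toggle : (x : Fin n) (σ : Subset n) → sgn (toggle x σ) ≡ ℤ.- sgn σ
sgn-toggle zero    (inside ∷ σ)  = sym (ℤ.neg-involutive _)
sgn-toggle zero    (outside ∷ σ) = refl
sgn-toggle (suc x) (inside ∷ σ)  = cong ℤ.-_ (sgn-toggle x σ)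
sgn-toggle (suc x) (outside ∷ σ) = sgn-toggle x σ

sgn-size : (σ : Subset n) → sgn σ ≡ -1ℤ ℤ.^ ∣ σ ∣
sgn-size []            = refl
sgn-size (inside ∷ σ)  = trans (sym (ℤ.-1*i≡-i (sgn σ))) (cong (-1ℤ ℤ.*_) (sgn-size σ))
sgn-size (outside ∷ σ) = sgn-size σ

alt : Decidable P → ℤ
alt P? = Σˢ λ σ → P? σ ▸ sgn σ

alt-cong : (P? : Decidable P) (Q? : Decidable Q) → (∀ {σ} → P σ → Q σ) → (∀ {σ} → Q σ → P σ) →
           alt P? ≡ alt Q?
alt-cong P? Q? f g = Σˢ-cong λ σ → ▸-cong (P? σ) (Q? σ) f g (λ _ → refl)

alt-empty : (P? : Decidable P) → (∀ {σ} → ¬ P σ) → alt P? ≡ 0ℤ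
alt-empty P? ¬P = Σˢ-zero λ σ → ▸-no (P? σ) ¬P

alt-split : (P? : Decidable P) (Q? : Decidable Q) →
            alt P? ≡ alt (λ σ → P? σ ×-dec Q? σ) ℤ.+ alt (λ σ → P? σ ×-dec ¬? (Q? σ))
alt-split P? Q? = trans (Σˢ-cong λ σ → ▸-split (P? σ) (Q? σ) (sgn σ))
                        (Σˢ-+ (λ σ → (P? σ ×-dec Q? σ) ▸ sgn σ) _)

toggle-involutive : (x : Fin n) (σ : Subset n) → toggle x (toggle x σ) ≡ σ
toggle-involutive zero    (inside ∷ σ)  = refl
toggle-involutive zero    (outside ∷ σ) = refl
toggle-involutive (suc x) (s ∷ σ)       = cong (s ∷_) (toggle-involutive x σ)

∈-toggle : {x y : Fin n} {σ : Subset n} → y ≢ x → y ∈ σ → y ∈ toggle x σ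
∈-toggle {y = y} {σ} y≢x y∈σ = Vec.updateAt-minimal y _ σ y≢x y∈σ

∈-toggle⁻ : {x y : Fin n} {σ : Subset n} → y ≢ x → y ∈ toggle x σ → y ∈ σ
∈-toggle⁻ {x = x} {σ = σ} y≢x y∈ = subst (_ ∈_) (toggle-involutive x σ) (∈-toggle y≢x y∈)

-- Toggling `x` is a sign-reversing involution on `P`. All cancellations of alternating sums below
-- come from this.
alt-toggle : (x : Fin n) (P? : Decidable P) → (∀ {σ} → P σ → P (toggle x σ)) → alt P? ≡ 0ℤ
alt-toggle {P = P} x P? tog = Σˢ-toggle x _ λ σ →
  trans (▸-cong (P? (toggle x σ)) (P? σ)
          (subst P (toggle-involutive x σ) ∘ tog) tog (λ _ → sgn-toggle x σ))
        (▸-neg (P? σ) (sgn σ))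

alt-∷ : {P : Pred (Subset (suc n)) 0ℓ} (P? : Decidable P) →
        alt P? ≡ ℤ.- alt (P? ∘ (inside ∷_)) ℤ.+ alt (P? ∘ (outside ∷_))
alt-∷ P? = cong (ℤ._+ alt (P? ∘ (outside ∷_)))
  (trans (Σˢ-cong λ σ → ▸-neg (P? (inside ∷ σ)) (sgn σ)) (Σˢ-neg λ σ → P? (inside ∷ σ) ▸ sgn σ))

-- Eulerian manifolds and their PL invariance

∪-lub : {σ τ ρ : Subset n} → σ ⊆ ρ → τ ⊆ ρ → σ ∪ τ ⊆ ρ
∪-lub {σ = σ} {τ} σ⊆ρ τ⊆ρ = [ σ⊆ρ , τ⊆ρ ]′ ∘ x∈p∪q⁻ σ τ

∪-absorb : {σ τ : Subset n} → σ ⊆ τ → σ ∪ τ ≡ τ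
∪-absorb {σ = σ} {τ} σ⊆τ = ⊆-antisym (∪-lub σ⊆τ id) (q⊆p∪q σ τ)

⁅⁆⊆ : {x : Fin n} {σ : Subset n} → x ∈ σ → ⁅ x ⁆ ⊆ σ
⁅⁆⊆ {x = x} x∈σ y∈ = subst (_∈ _) (sym (x∈⁅y⁆⇒x≡y x y∈)) x∈σ

⊈⇒∃ : {σ τ : Subset n} → σ ⊈ τ → ∃[ x ] x ∈ σ × x ∉ τ
⊈⇒∃ {σ = σ} {τ} σ⊈τ with Fin.any? (λ x → (x ∈? σ) ×-dec ¬? (x ∈? τ))
... | yes ex = ex
... | no ¬ex = contradiction (λ {x} x∈σ → decidable-stable (x ∈? τ) λ x∉τ → ¬ex (x , x∈σ , x∉τ)) σ⊈τ

x∉p-x : (x : Fin n) (p : Subset n) → x ∉ p - x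
x∉p-x zero    (inside ∷ p)  ()
x∉p-x zero    (outside ∷ p) ()
x∉p-x (suc x) (s ∷ p) (there x∈) = x∉p-x x p x∈

p-x⊆p : {p : Subset n} (x : Fin n) → p - x ⊆ p
p-x⊆p {p = p} x = p─q⊆p p ⁅ x ⁆

-‿⊆ : {σ τ : Subset n} {x : Fin n} → σ ⊆ τ → x ∉ σ → σ ⊆ τ - x
-‿⊆ σ⊆τ x∉σ y∈σ = x∈p∧x≢y⇒x∈p-y (σ⊆τ y∈σ) λ { refl → x∉σ y∈σ }

-‿mono : {σ τ : Subset n} (x : Fin n) → σ ⊆ τ → σ - x ⊆ τ - x
-‿mono x σ⊆τ = -‿⊆ (σ⊆τ ∘ p-x⊆p x) (x∉p-x x _)

∣p∣≤1+∣p-x∣ : (p : Subset n) (x : Fin n) → ∣ p ∣ ≤ suc ∣ p - x ∣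
∣p∣≤1+∣p-x∣ (inside ∷ p)  zero    = ℕ.≤-reflexive (cong (suc ∘ ∣_∣) (sym (p─⊥≡p p)))
∣p∣≤1+∣p-x∣ (outside ∷ p) zero    = ℕ.m≤n⇒m≤1+n (ℕ.≤-reflexive (cong ∣_∣ (sym (p─⊥≡p p))))
∣p∣≤1+∣p-x∣ (inside ∷ p)  (suc x) = s≤s (∣p∣≤1+∣p-x∣ p x)
∣p∣≤1+∣p-x∣ (outside ∷ p) (suc x) = ∣p∣≤1+∣p-x∣ p x

star? : (K : Complex n) (σ : Subset n) → Decidable (λ τ → σ ⊆ τ × Face K τ)
star? K σ τ = (σ ⊆? τ) ×-dec face? K τ

-- For a face σ of a d-dimensional sphere this is (-1)^(d+1), whatever σ is:
-- up to sign it is the reduced Euler characteristic of the link of σ.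
starSum : Complex n → Subset n → ℤ
starSum K σ = alt (star? K σ)

-- The constant is the value in dimension 2, that of the vertex links. The empty face is included,
-- so the total alternating sum is prescribed too.
IsEulerian : Complex n → Set
IsEulerian K = ∀ σ → Face K σ → starSum K σ ≡ -1ℤ

-- A lower bound on the size passes through `carrier` and `lift`, which never shrink a face but may
-- enlarge it.
Facet : ℕ → Complex n → Subset n → Set
Facet d K σ = Face K σ × suc d ≤ ∣ σ ∣

-- The common face `ρ` may be larger than a ridge, so a facet is adjacent to itself; chains may
-- therefore contain trivial steps.
Adj : ℕ → Complex n → Subset n → Subset n → Set
Adj d K σ τ = Facet d K σ × Facet d K τ × ∃[ ρ ] ρ ⊆ σ × ρ ⊆ τ × d ≤ ∣ ρ ∣

IsStronglyConnected : ℕ → Complex n → Set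
IsStronglyConnected d K = ∀ {σ τ} → Facet d K σ → Facet d K τ → Star (Adj d K) σ τ

record IsEulerianManifold (d : ℕ) (K : Complex n) : Set where
  field
    eulerian          : IsEulerian K
    stronglyConnected : IsStronglyConnected d K

open IsEulerianManifold

-- Invariance under simplicial isomorphism

module _ (f : Fin m → Fin n) where

  ∈-image⁺ : {σ : Subset m} {i : Fin m} → i ∈ σ → f i ∈ image f σ
  ∈-image⁺ {σ} {i} i∈σ = Vec.lookup⇒[]= (f i) _ (trans (Vec.lookup∘tabulate _ (f i))
    (dec-true (Fin.any? λ k → (k ∈? σ) ×-dec (f k Fin.≟ f i)) (i , i∈σ , refl)))

  ∈-image⁻ : (σ : Subset m) {j : Fin n} → j ∈ image f σ → ∃[ i ] i ∈ σ × f i ≡ j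
  ∈-image⁻ σ {j} j∈ with Fin.any? (λ k → (k ∈? σ) ×-dec (f k Fin.≟ j))
                         | trans (sym (Vec.lookup∘tabulate _ j)) (Vec.[]=⇒lookup j∈)
  ... | yes ex | _ = ex
  ... | no _   | ()

  image-mono : {σ τ : Subset m} → σ ⊆ τ → image f σ ⊆ image f τ
  image-mono {σ} σ⊆τ j∈ with ∈-image⁻ σ j∈
  ... | i , i∈σ , refl = ∈-image⁺ (σ⊆τ i∈σ)

∣p∪q∣≤∣p∣+∣q∣ : (p q : Subset n) → ∣ p ∪ q ∣ ≤ ∣ p ∣ + ∣ q ∣
∣p∪q∣≤∣p∣+∣q∣ []            []            = z≤n
∣p∪q∣≤∣p∣+∣q∣ (inside ∷ p)  (inside ∷ q)  =
  s≤s (ℕ.≤-trans (∣p∪q∣≤∣p∣+∣q∣ p q) (ℕ.+-monoʳ-≤ ∣ p ∣ (ℕ.n≤1+n _)))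
∣p∪q∣≤∣p∣+∣q∣ (inside ∷ p)  (outside ∷ q) = s≤s (∣p∪q∣≤∣p∣+∣q∣ p q)
∣p∪q∣≤∣p∣+∣q∣ (outside ∷ p) (inside ∷ q)  =
  subst (suc ∣ p ∪ q ∣ ≤_) (sym (ℕ.+-suc ∣ p ∣ ∣ q ∣)) (s≤s (∣p∪q∣≤∣p∣+∣q∣ p q))
∣p∪q∣≤∣p∣+∣q∣ (outside ∷ p) (outside ∷ q) = ∣p∪q∣≤∣p∣+∣q∣ p q

∣image∣≤ : (f : Fin m → Fin n) (σ : Subset m) → ∣ image f σ ∣ ≤ ∣ σ ∣
∣image∣≤ {n = n} f [] = subst (_≤ 0) (sym (trans (cong ∣_∣ empty) (∣⊥∣≡0 n))) z≤n
  where
  empty : image f [] ≡ ⊥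
  empty = Empty-unique λ (_ , j∈) → case ∈-image⁻ f [] j∈ of λ ()
∣image∣≤ f (outside ∷ σ) = ℕ.≤-trans (p⊆q⇒∣p∣≤∣q∣ sub) (∣image∣≤ (f ∘ suc) σ)
  where
  sub : image f (outside ∷ σ) ⊆ image (f ∘ suc) σ
  sub j∈ with ∈-image⁻ f (outside ∷ σ) j∈
  ... | suc i , there i∈σ , refl = ∈-image⁺ (f ∘ suc) i∈σ
∣image∣≤ f (inside ∷ σ) = begin
  ∣ image f (inside ∷ σ) ∣                ≤⟨ p⊆q⇒∣p∣≤∣q∣ sub ⟩
  ∣ ⁅ f zero ⁆ ∪ image (f ∘ suc) σ ∣      ≤⟨ ∣p∪q∣≤∣p∣+∣q∣ ⁅ f zero ⁆ _ ⟩
  (∣ ⁅ f zero ⁆ ∣) + (∣ image (f ∘ suc) σ ∣)  ≡⟨ cong (_+ ∣ image (f ∘ suc) σ ∣) (∣⁅x⁆∣≡1 (f zero)) ⟩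
  suc ∣ image (f ∘ suc) σ ∣               ≤⟨ s≤s (∣image∣≤ (f ∘ suc) σ) ⟩
  suc ∣ σ ∣                               ∎
  where
  open ℕ.≤-Reasoning
  sub : image f (inside ∷ σ) ⊆ ⁅ f zero ⁆ ∪ image (f ∘ suc) σ
  sub j∈ with ∈-image⁻ f (inside ∷ σ) j∈
  ... | zero  , here      , refl = p⊆p∪q _ (x∈⁅x⁆ (f zero))
  ... | suc i , there i∈σ , refl = q⊆p∪q ⁅ f zero ⁆ _ (∈-image⁺ (f ∘ suc) i∈σ)

-- `g` inverts `f` only at vertices of `K`, but every element of a face is a vertex.
image-inverse : (K : Complex m) {f : Fin m → Fin n} {g : Fin n → Fin m} →
                (∀ {v} → Vertex K v → g (f v) ≡ v) →
                ∀ {σ} → Face K σ → image g (image f σ) ≡ σ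
image-inverse K {f} {g} gf {σ} σ∈K = ⊆-antisym below above
  where
  vertex : ∀ {v} → v ∈ σ → Vertex K v
  vertex v∈σ = down-closed K (⁅⁆⊆ v∈σ) σ∈K
  below : image g (image f σ) ⊆ σ
  below k∈ with ∈-image⁻ g (image f σ) k∈
  ... | j , j∈ , refl with ∈-image⁻ f σ j∈
  ... | i , i∈σ , refl = subst (_∈ σ) (sym (gf (vertex i∈σ))) i∈σ
  above : σ ⊆ image g (image f σ)
  above i∈σ = subst (_∈ _) (gf (vertex i∈σ)) (∈-image⁺ g (∈-image⁺ f i∈σ))

≅-sym : {K : Complex m} {L : Complex n} → K ≅ L → L ≅ K
≅-sym iso = record
  { to = from ; from = to ; to-face = from-face ; from-face = to-face
  ; from∘to = to∘from ; to∘from = from∘to }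
  where open _≅_ iso

module Isomorphism {K : Complex m} {L : Complex n} (iso : K ≅ L) where
  open _≅_ iso

  from-to : ∀ {σ} → Face K σ → image from (image to σ) ≡ σ
  from-to = image-inverse K {to} {from} from∘to

  to-from : ∀ {τ} → Face L τ → image to (image from τ) ≡ τ
  to-from = image-inverse L {from} {to} to∘from

  -- Images never grow, and `from` brings the image back to `σ`, so neither map can shrink it.
  ∣image-to∣ : ∀ {σ} → Face K σ → ∣ image to σ ∣ ≡ ∣ σ ∣
  ∣image-to∣ {σ} σ∈K = ℕ.≤-antisym (∣image∣≤ to σ)
    (subst (λ ρ → ∣ ρ ∣ ≤ ∣ image to σ ∣) (from-to σ∈K) (∣image∣≤ from (image to σ)))

  starSum-≅ : ∀ {σ} → Face K σ → starSum K σ ≡ starSum L (image to σ)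
  starSum-≅ {σ} σ∈K = Σˢ-bijection (star? K σ) (star? L (image to σ)) sgn sgn (image to) (image from)
    (λ (σ⊆τ , τ∈K) → image-mono to σ⊆τ , to-face τ∈K)
    (λ (φσ⊆τ , τ∈L) → subst (_⊆ _) (from-to σ∈K) (image-mono from φσ⊆τ) , from-face τ∈L)
    (λ (_ , τ∈K) → from-to τ∈K)
    (λ (_ , τ∈L) → to-from τ∈L)
    (λ {τ} (_ , τ∈K) → trans (sgn-size τ)
      (trans (cong (-1ℤ ℤ.^_) (sym (∣image-to∣ τ∈K))) (sym (sgn-size (image to τ)))))

  adj-≅ : ∀ {d σ τ} → Adj d K σ τ → Adj d L (image to σ) (image to τ)
  adj-≅ ((σ∈K , ∣σ∣) , (τ∈K , ∣τ∣) , ρ , ρ⊆σ , ρ⊆τ , ∣ρ∣) =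
    (to-face σ∈K , subst (_ ≤_) (sym (∣image-to∣ σ∈K)) ∣σ∣) ,
    (to-face τ∈K , subst (_ ≤_) (sym (∣image-to∣ τ∈K)) ∣τ∣) ,
    image to ρ , image-mono to ρ⊆σ , image-mono to ρ⊆τ ,
    subst (_ ≤_) (sym (∣image-to∣ (down-closed K ρ⊆σ σ∈K))) ∣ρ∣

manifold-≅ : ∀ {d} {K : Complex m} {L : Complex n} → K ≅ L →
             IsEulerianManifold d K → IsEulerianManifold d L
manifold-≅ {d = d} {K} {L} iso mfd = record
  { eulerian = λ τ τ∈L → trans (L.starSum-≅ τ∈L) (eulerian mfd _ (from-face τ∈L))
  ; stronglyConnected = λ {σ} {τ} (σ∈L , ∣σ∣) (τ∈L , ∣τ∣) →
      subst₂ (Star (Adj d L)) (K.to-from σ∈L) (K.to-from τ∈L)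
        (gmap (image to) K.adj-≅ (stronglyConnected mfd
          (from-face σ∈L , subst (_ ≤_) (sym (L.∣image-to∣ σ∈L)) ∣σ∣)
          (from-face τ∈L , subst (_ ≤_) (sym (L.∣image-to∣ τ∈L)) ∣τ∣)))
  }
  where
  open _≅_ iso
  module K = Isomorphism iso
  module L = Isomorphism (≅-sym iso)

+≡0⇒≡- : ∀ {b c} → b ℤ.+ c ≡ 0ℤ → b ≡ ℤ.- c
+≡0⇒≡- {b} {c} eq = trans (expand b c) (trans (cong (ℤ._- c) eq) (ℤ.+-identityˡ _))
  where
  expand : ∀ b c → b ≡ (b ℤ.+ c) ℤ.- c
  expand = solve-∀

-- Invariance under stellar subdivision

joinStar? : (K : Complex n) (s τ₀ : Subset n) → Decidable (λ τ → τ₀ ⊆ τ × Face K (s ∪ τ))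
joinStar? K s τ₀ τ = (τ₀ ⊆? τ) ×-dec face? K (s ∪ τ)

-- Toggling a vertex y of s outside τ₀ does not change s ∪ τ.
joinStar-cancels : (K : Complex n) {s τ₀ : Subset n} → s ⊈ τ₀ → alt (joinStar? K s τ₀) ≡ 0ℤ
joinStar-cancels K {s} {τ₀} s⊈τ₀ with ⊈⇒∃ s⊈τ₀
... | y , y∈s , y∉τ₀ = alt-toggle y (joinStar? K s τ₀) λ {τ} (τ₀⊆τ , sτ∈K) →
  (λ z∈τ₀ → ∈-toggle (λ { refl → y∉τ₀ z∈τ₀ }) (τ₀⊆τ z∈τ₀)) ,
  down-closed K (∪-lub (p⊆p∪q τ) λ {z} z∈ → case z Fin.≟ y of λ where
    (yes refl) → p⊆p∪q τ y∈s
    (no z≢y)   → q⊆p∪q s τ (∈-toggle⁻ z≢y z∈)) sτ∈K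

module StellarSubdivision (K : Complex n) (s : Subset n) (ne : Nonempty s) (s∈K : Face K s) where

  K′ : Complex (suc n)
  K′ = stellar K s ne s∈K

  module _ (τ₀ : Subset n) (s⊈τ₀ : s ⊈ τ₀) where

    -- The faces over `τ₀` that the subdivision removes, those that it keeps, and the bases of the
    -- new cone faces, counted without the sign of the apex.
    inStar outStar coneStar : ℤ
    inStar   = alt (λ τ → star? K τ₀ τ ×-dec (s ⊆? τ))
    outStar  = alt (λ τ → star? K τ₀ τ ×-dec ¬? (s ⊆? τ))
    coneStar = alt (λ τ → joinStar? K s τ₀ τ ×-dec ¬? (s ⊆? τ))

    -- Together the two families consist of all `τ` over `τ₀` with `s ∪ τ` a face, and that sum
    -- vanishes by `joinStar-cancels`.
    inStar≡-coneStar : inStar ≡ ℤ.- coneStar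
    inStar≡-coneStar = +≡0⇒≡- (trans (cong (ℤ._+ coneStar) inStar≡)
      (trans (sym (alt-split (joinStar? K s τ₀) (s ⊆?_))) (joinStar-cancels K s⊈τ₀)))
      where
      inStar≡ : inStar ≡ alt (λ τ → joinStar? K s τ₀ τ ×-dec (s ⊆? τ))
      inStar≡ = alt-cong (λ τ → star? K τ₀ τ ×-dec (s ⊆? τ)) (λ τ → joinStar? K s τ₀ τ ×-dec (s ⊆? τ))
        (λ ((τ₀⊆τ , τ∈K) , s⊆τ) → (τ₀⊆τ , subst (Face K) (sym (∪-absorb s⊆τ)) τ∈K) , s⊆τ)
        (λ ((τ₀⊆τ , sτ∈K) , s⊆τ) → (τ₀⊆τ , subst (Face K) (∪-absorb s⊆τ) sτ∈K) , s⊆τ)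

    -- Only cone faces contain the apex, whose sign turns `coneStar` into `inStar`; the faces
    -- counted there are exactly those over `s ∪ τ₀`.
    starSum-inside : starSum K′ (inside ∷ τ₀) ≡ starSum K (s ∪ τ₀)
    starSum-inside = begin
      starSum K′ (inside ∷ τ₀)
        ≡⟨ alt-∷ (star? K′ (inside ∷ τ₀)) ⟩
      ℤ.- alt (star? K′ (inside ∷ τ₀) ∘ (inside ∷_)) ℤ.+ alt (star? K′ (inside ∷ τ₀) ∘ (outside ∷_))
        ≡⟨ cong₂ (λ y z → ℤ.- y ℤ.+ z)
             (alt-cong (star? K′ (inside ∷ τ₀) ∘ (inside ∷_)) (λ τ → joinStar? K s τ₀ τ ×-dec ¬? (s ⊆? τ))
               (λ (τ₀⊆τ , sτ∈K , s⊈τ) → (drop-∷-⊆ τ₀⊆τ , sτ∈K) , s⊈τ)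
               (λ ((τ₀⊆τ , sτ∈K) , s⊈τ) → s⊆s τ₀⊆τ , sτ∈K , s⊈τ))
             (alt-empty (star? K′ (inside ∷ τ₀) ∘ (outside ∷_)) λ (ρ⊆ , _) → case ρ⊆ here of λ ()) ⟩
      ℤ.- coneStar ℤ.+ 0ℤ
        ≡⟨ ℤ.+-identityʳ _ ⟩
      ℤ.- coneStar
        ≡⟨ inStar≡-coneStar ⟨
      inStar
        ≡⟨ alt-cong (λ τ → star? K τ₀ τ ×-dec (s ⊆? τ)) (star? K (s ∪ τ₀))
             (λ ((τ₀⊆τ , τ∈K) , s⊆τ) → ∪-lub s⊆τ τ₀⊆τ , τ∈K)
             (λ (sτ₀⊆τ , τ∈K) → ((sτ₀⊆τ ∘ q⊆p∪q s τ₀) , τ∈K) , sτ₀⊆τ ∘ p⊆p∪q τ₀) ⟩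
      starSum K (s ∪ τ₀) ∎
      where open ≡-Reasoning

    -- The removed faces are replaced by cone faces of the same total, because the apex reverses the
    -- sign of `coneStar`.
    starSum-outside : starSum K′ (outside ∷ τ₀) ≡ starSum K τ₀
    starSum-outside = begin
      starSum K′ (outside ∷ τ₀)
        ≡⟨ alt-∷ (star? K′ (outside ∷ τ₀)) ⟩
      ℤ.- alt (star? K′ (outside ∷ τ₀) ∘ (inside ∷_)) ℤ.+ alt (star? K′ (outside ∷ τ₀) ∘ (outside ∷_))
        ≡⟨ cong₂ (λ y z → ℤ.- y ℤ.+ z)
             (alt-cong (star? K′ (outside ∷ τ₀) ∘ (inside ∷_)) (λ τ → joinStar? K s τ₀ τ ×-dec ¬? (s ⊆? τ))
               (λ (τ₀⊆τ , sτ∈K , s⊈τ) → (drop-∷-⊆ τ₀⊆τ , sτ∈K) , s⊈τ)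
               (λ ((τ₀⊆τ , sτ∈K) , s⊈τ) → out⊆ τ₀⊆τ , sτ∈K , s⊈τ))
             (alt-cong (star? K′ (outside ∷ τ₀) ∘ (outside ∷_)) (λ τ → star? K τ₀ τ ×-dec ¬? (s ⊆? τ))
               (λ (τ₀⊆τ , τ∈K , s⊈τ) → (drop-∷-⊆ τ₀⊆τ , τ∈K) , s⊈τ)
               (λ ((τ₀⊆τ , τ∈K) , s⊈τ) → out⊆ τ₀⊆τ , τ∈K , s⊈τ)) ⟩
      ℤ.- coneStar ℤ.+ outStar
        ≡⟨ cong (ℤ._+ outStar) inStar≡-coneStar ⟨
      inStar ℤ.+ outStar
        ≡⟨ alt-split (star? K τ₀) (s ⊆?_) ⟨
      starSum K τ₀ ∎
      where open ≡-Reasoning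

  -- With the apex placed in the interior of `s`, this is the smallest face of `K` that contains the
  -- simplex geometrically.
  carrier : Subset (suc n) → Subset n
  carrier (inside ∷ τ)  = s ∪ τ
  carrier (outside ∷ τ) = τ

  carrier-face : ∀ σ → Face K′ σ → Face K (carrier σ)
  carrier-face (inside ∷ τ)  (sτ∈K , _) = sτ∈K
  carrier-face (outside ∷ τ) (τ∈K , _)  = τ∈K

  carrier-mono : ∀ {σ τ} → σ ⊆ τ → carrier σ ⊆ carrier τ
  carrier-mono {inside ∷ σ}  {inside ∷ τ}  σ⊆τ = ∪-monoʳ-⊆ s (drop-∷-⊆ σ⊆τ)
  carrier-mono {inside ∷ σ}  {outside ∷ τ} σ⊆τ = case σ⊆τ here of λ ()
  carrier-mono {outside ∷ σ} {inside ∷ τ}  σ⊆τ = q⊆p∪q s τ ∘ drop-∷-⊆ σ⊆τ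
  carrier-mono {outside ∷ σ} {outside ∷ τ} σ⊆τ = drop-∷-⊆ σ⊆τ

  -- The apex is traded for at least one vertex of `s` missing from the base.
  ∣carrier∣ : ∀ σ → Face K′ σ → ∣ σ ∣ ≤ ∣ carrier σ ∣
  ∣carrier∣ (inside ∷ τ)  (_ , s⊈τ) with ⊈⇒∃ s⊈τ
  ... | y , y∈s , y∉τ = p⊂q⇒∣p∣<∣q∣ (q⊆p∪q s τ , y , p⊆p∪q τ y∈s , y∉τ)
  ∣carrier∣ (outside ∷ τ) _ = ℕ.≤-refl

  starSum-carrier : ∀ σ → Face K′ σ → starSum K′ σ ≡ starSum K (carrier σ)
  starSum-carrier (inside ∷ τ)  (_ , s⊈τ) = starSum-inside τ s⊈τ
  starSum-carrier (outside ∷ τ) (_ , s⊈τ) = starSum-outside τ s⊈τ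

  carrier-facet : ∀ {σ} → Facet d K′ σ → Facet d K (carrier σ)
  carrier-facet (σ∈K′ , ∣σ∣) = carrier-face _ σ∈K′ , ℕ.≤-trans ∣σ∣ (∣carrier∣ _ σ∈K′)

  carrier-adj : ∀ {σ τ} → Adj d K′ σ τ → Adj d K (carrier σ) (carrier τ)
  carrier-adj (σ-facet@(σ∈K′ , _) , τ-facet , ρ , ρ⊆σ , ρ⊆τ , ∣ρ∣) =
    carrier-facet σ-facet , carrier-facet τ-facet ,
    carrier ρ , carrier-mono ρ⊆σ , carrier-mono ρ⊆τ ,
    ℕ.≤-trans ∣ρ∣ (∣carrier∣ ρ (down-closed K′ ρ⊆σ σ∈K′))

  -- A section of carrier for each y ∈ s.
  lift : Fin n → Subset n → Subset (suc n)
  lift y τ = if does (s ⊆? τ) then inside ∷ (τ - y) else outside ∷ τ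

  module _ {y : Fin n} (y∈s : y ∈ s) where

    carrier-lift : ∀ τ → carrier (lift y τ) ≡ τ
    carrier-lift τ with s ⊆? τ
    ... | no _    = refl
    ... | yes s⊆τ = ⊆-antisym (∪-lub s⊆τ (p-x⊆p y)) λ {z} z∈τ → case z Fin.≟ y of λ where
      (yes refl) → p⊆p∪q (τ - y) y∈s
      (no z≢y)   → q⊆p∪q s (τ - y) (x∈p∧x≢y⇒x∈p-y z∈τ z≢y)

    lift-face : ∀ {τ} → Face K τ → Face K′ (lift y τ)
    lift-face {τ} τ∈K with s ⊆? τ
    ... | no s⊈τ  = τ∈K , s⊈τ
    ... | yes s⊆τ = down-closed K (∪-lub s⊆τ (p-x⊆p y)) τ∈K , λ s⊆τ-y → x∉p-x y τ (s⊆τ-y y∈s)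

    ∣lift∣ : ∀ τ → ∣ τ ∣ ≤ ∣ lift y τ ∣
    ∣lift∣ τ with s ⊆? τ
    ... | no _  = ℕ.≤-refl
    ... | yes _ = ∣p∣≤1+∣p-x∣ τ y

    lift-facet : ∀ {τ} → Facet d K τ → Facet d K′ (lift y τ)
    lift-facet {τ = τ} (τ∈K , ∣τ∣) = lift-face τ∈K , ℕ.≤-trans ∣τ∣ (∣lift∣ τ)

  lift-inside : ∀ y {τ} → s ⊆ τ → lift y τ ≡ inside ∷ (τ - y)
  lift-inside y {τ} s⊆τ with s ⊆? τ
  ... | yes _  = refl
  ... | no s⊈τ = contradiction (λ {x} → s⊆τ {x}) s⊈τ

  lift-outside : ∀ y {τ} → s ⊈ τ → lift y τ ≡ outside ∷ τ
  lift-outside y {τ} s⊈τ with s ⊆? τ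
  ... | yes s⊆τ = contradiction (λ {x} → s⊆τ {x}) s⊈τ
  ... | no _    = refl

  -- The pieces into which `τ` is subdivided each omit one vertex of `s`; two of them share the apex
  -- and `τ` without both omitted vertices.
  lift-lift : ∀ {y z τ} → y ∈ s → z ∈ s → Facet d K τ → Adj d K′ (lift y τ) (lift z τ)
  lift-lift {d} {y} {z} {τ} y∈s z∈s τ-facet@(_ , ∣τ∣) =
    lift-facet y∈s τ-facet , lift-facet z∈s τ-facet , ridge
    where
    ridge : ∃[ ρ ] ρ ⊆ lift y τ × ρ ⊆ lift z τ × d ≤ ∣ ρ ∣
    ridge with s ⊆? τ
    ... | no _  = outside ∷ τ , id , id , ℕ.≤-trans (ℕ.n≤1+n d) ∣τ∣
    ... | yes _ = inside ∷ (τ - y - z) , s⊆s (p-x⊆p z) , s⊆s (-‿mono z (p-x⊆p y)) ,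
      ℕ.≤-pred (ℕ.≤-trans ∣τ∣ (ℕ.≤-trans (∣p∣≤1+∣p-x∣ τ y) (s≤s (∣p∣≤1+∣p-x∣ (τ - y) z))))

  -- The base of a cone face misses some `y` in `s`, so it survives the removal of `y` from the
  -- carrier. A face without the apex is its own lift.
  face-lift : ∀ σ → Face K′ σ → ∃[ y ] y ∈ s × σ ⊆ lift y (carrier σ)
  face-lift (inside ∷ τ) (_ , s⊈τ) with ⊈⇒∃ s⊈τ
  ... | y , y∈s , y∉τ = y , y∈s , subst (inside ∷ τ ⊆_) (sym (lift-inside y (p⊆p∪q τ)))
                                    (s⊆s (-‿⊆ (q⊆p∪q s τ) y∉τ))
  face-lift (outside ∷ τ) (_ , s⊈τ) =
    proj₁ ne , proj₂ ne , subst (outside ∷ τ ⊆_) (sym (lift-outside _ s⊈τ)) id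

  facet-lift : ∀ {σ} → Facet d K′ σ → ∃[ y ] y ∈ s × Adj d K′ σ (lift y (carrier σ))
  facet-lift {d} {σ} σ-facet@(σ∈K′ , ∣σ∣) with face-lift σ σ∈K′
  ... | y , y∈s , σ⊆ = y , y∈s , σ-facet , lift-facet y∈s (carrier-facet σ-facet) ,
                       σ , id , σ⊆ , ℕ.≤-trans (ℕ.n≤1+n d) ∣σ∣

  -- One `y` must serve every `τ` over `ρ`. If `ρ` misses a vertex of `s`, removing that vertex from
  -- `τ` leaves `ρ` intact; if `s ⊆ ρ`, both lifts contain the apex and any `y` works.
  ridge-lift : ∀ ρ → ∃[ y ] y ∈ s × (∀ {τ} → ρ ⊆ τ → lift y ρ ⊆ lift y τ)
  ridge-lift ρ with s ⊆? ρ
  ... | yes s⊆ρ = proj₁ ne , proj₂ ne , λ ρ⊆τ →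
    subst (_ ⊆_) (sym (lift-inside _ (ρ⊆τ ∘ s⊆ρ))) (s⊆s (-‿mono (proj₁ ne) ρ⊆τ))
  ... | no s⊈ρ with ⊈⇒∃ s⊈ρ
  ... | y , y∈s , y∉ρ = y , y∈s , below
    where
    below : ∀ {τ} → ρ ⊆ τ → outside ∷ ρ ⊆ lift y τ
    below {τ} ρ⊆τ with s ⊆? τ
    ... | yes _ = out⊆ (-‿⊆ ρ⊆τ y∉ρ)
    ... | no _  = s⊆s ρ⊆τ

  adj-sym : ∀ {d} {σ τ} → Adj d K′ σ τ → Adj d K′ τ σ
  adj-sym (σ-facet , τ-facet , ρ , ρ⊆σ , ρ⊆τ , ∣ρ∣) = τ-facet , σ-facet , ρ , ρ⊆τ , ρ⊆σ , ∣ρ∣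

  -- Move inside the subdivided `σ` to the piece chosen for the ridge `ρ`, cross the lifted ridge,
  -- then move inside the subdivided `τ`.
  lift-adj : ∀ {y z σ τ} → y ∈ s → z ∈ s → Adj d K σ τ → Star (Adj d K′) (lift y σ) (lift z τ)
  lift-adj y∈s z∈s (σ-facet , τ-facet , ρ , ρ⊆σ , ρ⊆τ , ∣ρ∣) with ridge-lift ρ
  ... | x , x∈s , mono =
    lift-lift y∈s x∈s σ-facet ◅
    (lift-facet x∈s σ-facet , lift-facet x∈s τ-facet ,
     lift x ρ , mono ρ⊆σ , mono ρ⊆τ , ℕ.≤-trans ∣ρ∣ (∣lift∣ x∈s ρ)) ◅
    lift-lift x∈s z∈s τ-facet ◅ ε

  lift-star : ∀ {y z σ τ} → y ∈ s → z ∈ s → Facet d K σ → Star (Adj d K) σ τ →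
              Star (Adj d K′) (lift y σ) (lift z τ)
  lift-star y∈s z∈s σ-facet ε             = lift-lift y∈s z∈s σ-facet ◅ ε
  lift-star y∈s z∈s _ (adj@(_ , ρ-facet , _) ◅ path) =
    lift-adj y∈s z∈s adj ◅◅ lift-star z∈s z∈s ρ-facet path

  manifold-stellar⁺ : IsEulerianManifold d K → IsEulerianManifold d K′
  manifold-stellar⁺ {d} mfd = record
    { eulerian = λ σ σ∈K′ →
        trans (starSum-carrier σ σ∈K′) (eulerian mfd (carrier σ) (carrier-face σ σ∈K′))
    ; stronglyConnected = connect
    }
    where
    connect : IsStronglyConnected d K′
    connect σ-facet τ-facet with facet-lift σ-facet | facet-lift τ-facet
    ... | y , y∈s , σ-adj | z , z∈s , τ-adj =
      σ-adj ◅ lift-star y∈s z∈s (carrier-facet σ-facet)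
                (stronglyConnected mfd (carrier-facet σ-facet) (carrier-facet τ-facet))
      ◅◅ adj-sym τ-adj ◅ ε

  -- For a fixed vertex `x` of `s`, every face of `K` is the carrier of its lift at `x`, so sums and
  -- chains of facets descend along `carrier`.
  manifold-stellar⁻ : IsEulerianManifold d K′ → IsEulerianManifold d K
  manifold-stellar⁻ {d} mfd = record
    { eulerian = λ τ τ∈K → begin
        starSum K τ                        ≡⟨ cong (starSum K) (carrier-lift x∈s τ) ⟨
        starSum K (carrier (lift x τ))     ≡⟨ starSum-carrier (lift x τ) (lift-face x∈s τ∈K) ⟨
        starSum K′ (lift x τ)              ≡⟨ eulerian mfd (lift x τ) (lift-face x∈s τ∈K) ⟩
        -1ℤ                                ∎
    ; stronglyConnected = λ {σ} {τ} σ-facet τ-facet →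
        subst₂ (Star (Adj d K)) (carrier-lift x∈s σ) (carrier-lift x∈s τ)
          (gmap carrier carrier-adj
            (stronglyConnected mfd (lift-facet x∈s σ-facet) (lift-facet x∈s τ-facet)))
    }
    where
    open ≡-Reasoning
    x = proj₁ ne
    x∈s = proj₂ ne

manifold-≈PL : {K : Complex m} {L : Complex n} → K ≈PL L →
               IsEulerianManifold d L → IsEulerianManifold d K
manifold-≈PL ε mfd = mfd
manifold-≈PL (fwd (relabel iso) ◅ moves) mfd = manifold-≅ (≅-sym iso) (manifold-≈PL moves mfd)
manifold-≈PL (bwd (relabel iso) ◅ moves) mfd = manifold-≅ iso (manifold-≈PL moves mfd)
manifold-≈PL (fwd (subdivide K s ne s∈K) ◅ moves) mfd =
  StellarSubdivision.manifold-stellar⁻ K s ne s∈K (manifold-≈PL moves mfd)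
manifold-≈PL (bwd (subdivide K s ne s∈K) ◅ moves) mfd =
  StellarSubdivision.manifold-stellar⁺ K s ne s∈K (manifold-≈PL moves mfd)

-- The boundary of the tetrahedron, and with it all combinatorial 2-spheres

∣p∪q∣+∣p∩q∣ : (p q : Subset n) → (∣ p ∪ q ∣) + (∣ p ∩ q ∣) ≡ (∣ p ∣) + (∣ q ∣)
∣p∪q∣+∣p∩q∣ []            []            = refl
∣p∪q∣+∣p∩q∣ (inside ∷ p)  (inside ∷ q)  = cong suc (trans (ℕ.+-suc ∣ p ∪ q ∣ _)
  (trans (cong suc (∣p∪q∣+∣p∩q∣ p q)) (sym (ℕ.+-suc ∣ p ∣ _))))
∣p∪q∣+∣p∩q∣ (inside ∷ p)  (outside ∷ q) = cong suc (∣p∪q∣+∣p∩q∣ p q)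
∣p∪q∣+∣p∩q∣ (outside ∷ p) (inside ∷ q)  =
  trans (cong suc (∣p∪q∣+∣p∩q∣ p q)) (sym (ℕ.+-suc ∣ p ∣ _))
∣p∪q∣+∣p∩q∣ (outside ∷ p) (outside ∷ q) = ∣p∪q∣+∣p∩q∣ p q

∂Δ³-manifold : IsEulerianManifold 2 (∂Δ 3)
∂Δ³-manifold = record
  -- A counterexample among the subsets of four labels is excluded by exhaustive evaluation.
  { eulerian = λ σ σ∈∂Δ → decidable-stable (starSum (∂Δ 3) σ ℤ.≟ -1ℤ) λ ≢-1 →
      from-no (anySubset? λ σ → (σ ⊂? ⊤) ×-dec ¬? (starSum (∂Δ 3) σ ℤ.≟ -1ℤ)) (σ , σ∈∂Δ , ≢-1)
  ; stronglyConnected = λ {σ} {τ} σ-facet@(_ , ∣σ∣) τ-facet@(_ , ∣τ∣) →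
      (σ-facet , τ-facet , σ ∩ τ , p∩q⊆p σ τ , p∩q⊆q σ τ ,
       -- Two sets of at least three labels out of four share at least two, since 3 + 3 = 4 + 2.
       ℕ.+-cancelˡ-≤ 4 _ _ (ℕ.≤-trans (ℕ.+-mono-≤ ∣σ∣ ∣τ∣)
         (ℕ.≤-trans (ℕ.≤-reflexive (sym (∣p∪q∣+∣p∩q∣ σ τ))) (ℕ.+-monoˡ-≤ _ (∣p∣≤n (σ ∪ τ)))))) ◅ ε
  }

sphere-manifold : {K : Complex n} → IsCombinatorialSphere 2 K → IsEulerianManifold 2 K
sphere-manifold K≈∂Δ = manifold-≈PL K≈∂Δ ∂Δ³-manifold

-- Tetrahedra around a face of a 3-manifold

⊆∧∣∣≤⇒≡ : {p q : Subset n} → p ⊆ q → ∣ q ∣ ≤ ∣ p ∣ → p ≡ q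
⊆∧∣∣≤⇒≡ {p = p} {q} p⊆q ∣q∣≤∣p∣ = ⊆-antisym p⊆q (decidable-stable (q ⊆? p) λ q⊈p →
  ℕ.<⇒≱ (p⊂q⇒∣p∣<∣q∣ (p⊆q , ⊈⇒∃ q⊈p)) ∣q∣≤∣p∣)

∣∣<⇒⊈ : {p q : Subset n} → suc ∣ p ∣ ≤ ∣ q ∣ → q ⊈ p
∣∣<⇒⊈ ∣p∣<∣q∣ q⊆p = ℕ.<⇒≱ ∣p∣<∣q∣ (p⊆q⇒∣p∣≤∣q∣ q⊆p)

1≤∣∣⇒Nonempty : {p : Subset n} → 1 ≤ ∣ p ∣ → Nonempty p
1≤∣∣⇒Nonempty {n} {p} 1≤∣p∣ with ⊈⇒∃ (∣∣<⇒⊈ {p = ⊥} {p} (subst (λ k → suc k ≤ ∣ p ∣) (sym (∣⊥∣≡0 n)) 1≤∣p∣))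
... | x , x∈p , _ = x , x∈p

Nonempty⇒1≤∣∣ : {p : Subset n} → Nonempty p → 1 ≤ ∣ p ∣
Nonempty⇒1≤∣∣ (x , x∈p) = subst (_≤ _) (∣⁅x⁆∣≡1 x) (p⊆q⇒∣p∣≤∣q∣ (⁅⁆⊆ x∈p))

2≤∣∣ : {p : Subset n} {x y : Fin n} → x ∈ p → y ∈ p → x ≢ y → 2 ≤ ∣ p ∣
2≤∣∣ {x = x} {y} x∈p y∈p x≢y = subst (λ k → suc k ≤ _) (∣⁅x⁆∣≡1 x)
  (p⊂q⇒∣p∣<∣q∣ (⁅⁆⊆ x∈p , y , y∈p , λ y∈⁅x⁆ → x≢y (sym (x∈⁅y⁆⇒x≡y x y∈⁅x⁆))))

∣⁅x⁆∪p∣ : {p : Subset n} (x : Fin n) → x ∉ p → suc ∣ p ∣ ≤ ∣ ⁅ x ⁆ ∪ p ∣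
∣⁅x⁆∪p∣ {p = p} x x∉p = p⊂q⇒∣p∣<∣q∣ (q⊆p∪q ⁅ x ⁆ p , x , p⊆p∪q p (x∈⁅x⁆ x) , x∉p)

⁅x⁆∪p-x⊆p : {p : Subset n} {x : Fin n} → x ∈ p → ⁅ x ⁆ ∪ (p - x) ⊆ p
⁅x⁆∪p-x⊆p {x = x} x∈p = ∪-lub (⁅⁆⊆ x∈p) (p-x⊆p x)

p⊆⁅x⁆∪p-x : (p : Subset n) (x : Fin n) → p ⊆ ⁅ x ⁆ ∪ (p - x)
p⊆⁅x⁆∪p-x p x {z} z∈p with z Fin.≟ x
... | yes refl = p⊆p∪q (p - x) (x∈⁅x⁆ x)
... | no z≢x   = q⊆p∪q ⁅ x ⁆ (p - x) (x∈p∧x≢y⇒x∈p-y z∈p z≢x)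

∈-vertices⁻ : (K : Complex n) {v : Fin n} → v ∈ vertices K → Vertex K v
∈-vertices⁻ K {v} v∈ with face? K ⁅ v ⁆ | trans (sym (Vec.lookup∘tabulate _ v)) (Vec.[]=⇒lookup v∈)
... | yes v∈K | _ = v∈K
... | no _    | ()

∈-vertices⁺ : (K : Complex n) {v : Fin n} → Vertex K v → v ∈ vertices K
∈-vertices⁺ K {v} v∈K =
  Vec.lookup⇒[]= v _ (trans (Vec.lookup∘tabulate _ v) (dec-true (face? K ⁅ v ⁆) v∈K))

-- The sum over all `τ` containing `σ - v` with `⁅ v ⁆ ∪ τ` a face vanishes. Its terms with `v ∈ τ`
-- form the star of `σ`, the others the star of `σ - v` in the link.
starSum-link : (K : Complex n) {v : Fin n} (v∈K : Vertex K v) {σ : Subset n} → v ∈ σ →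
               starSum K σ ≡ ℤ.- starSum (link K v v∈K) (σ - v)
starSum-link K {v} v∈K {σ} v∈σ = +≡0⇒≡- (begin
  starSum K σ ℤ.+ starSum (link K v v∈K) (σ - v)
    ≡⟨ cong₂ ℤ._+_
         (alt-cong (star? K σ) (λ τ → join? τ ×-dec (v ∈? τ))
           (λ (σ⊆τ , τ∈K) → (σ⊆τ ∘ p-x⊆p v , down-closed K (∪-lub (⁅⁆⊆ (σ⊆τ v∈σ)) id) τ∈K) , σ⊆τ v∈σ)
           (λ {τ} ((σ-v⊆τ , vτ∈K) , v∈τ) →
             (∪-lub (⁅⁆⊆ v∈τ) σ-v⊆τ ∘ p⊆⁅x⁆∪p-x σ v) , down-closed K (q⊆p∪q ⁅ v ⁆ τ) vτ∈K))
         (alt-cong (star? (link K v v∈K) (σ - v)) (λ τ → join? τ ×-dec ¬? (v ∈? τ))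
           (λ (σ-v⊆τ , v∉τ , vτ∈K) → (σ-v⊆τ , vτ∈K) , v∉τ)
           (λ ((σ-v⊆τ , vτ∈K) , v∉τ) → σ-v⊆τ , v∉τ , vτ∈K)) ⟩
  alt (λ τ → join? τ ×-dec (v ∈? τ)) ℤ.+ alt (λ τ → join? τ ×-dec ¬? (v ∈? τ))
    ≡⟨ alt-split join? (v ∈?_) ⟨
  alt join?
    ≡⟨ joinStar-cancels K (λ ⁅v⁆⊆ → x∉p-x v σ (⁅v⁆⊆ (x∈⁅x⁆ v))) ⟩
  0ℤ ∎)
  where
  open ≡-Reasoning
  join? = joinStar? K ⁅ v ⁆ (σ - v)

card-remove : (P? : Decidable P) {τ : Subset n} → P τ →
              card P? ≡ 1ℤ ℤ.+ card (λ σ → P? σ ×-dec ¬? (σ ≟ˢ τ))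
card-remove P? {τ} Pτ = begin
  card P?
    ≡⟨ Σˢ-cong (λ σ → ▸-split (P? σ) (σ ≟ˢ τ) 1ℤ) ⟩
  Σˢ (λ σ → ((P? σ ×-dec (σ ≟ˢ τ)) ▸ 1ℤ) ℤ.+ ((P? σ ×-dec ¬? (σ ≟ˢ τ)) ▸ 1ℤ))
    ≡⟨ Σˢ-+ (λ σ → (P? σ ×-dec (σ ≟ˢ τ)) ▸ 1ℤ) _ ⟩
  card (λ σ → P? σ ×-dec (σ ≟ˢ τ)) ℤ.+ card (λ σ → P? σ ×-dec ¬? (σ ≟ˢ τ))
    ≡⟨ cong (ℤ._+ card (λ σ → P? σ ×-dec ¬? (σ ≟ˢ τ))) (trans
         (Σˢ-cong λ σ → ▸-cong (P? σ ×-dec (σ ≟ˢ τ)) (σ ≟ˢ τ) proj₂ (λ { refl → Pτ , refl }) (λ _ → refl))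
         (Σˢ-δ τ 1ℤ)) ⟩
  1ℤ ℤ.+ card (λ σ → P? σ ×-dec ¬? (σ ≟ˢ τ)) ∎
  where open ≡-Reasoning

card-nonneg : (P? : Decidable P) → 0ℤ ℤ.≤ card P?
card-nonneg P? = subst (0ℤ ℤ.≤_) (♯≡card P?) (+≤+ z≤n)

card-three : (P? : Decidable P) {ρ σ τ : Subset n} → P ρ → P σ → P τ → σ ≢ ρ → τ ≢ ρ → τ ≢ σ →
             + 3 ℤ.≤ card P?
card-three P? {ρ} {σ} {τ} Pρ Pσ Pτ σ≢ρ τ≢ρ τ≢σ =
  subst (+ 3 ℤ.≤_) (sym count) (ℤ.+-monoʳ-≤ (+ 3) (card-nonneg P₃?))
  where
  P₁? = λ υ → P? υ ×-dec ¬? (υ ≟ˢ ρ)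
  P₂? = λ υ → P₁? υ ×-dec ¬? (υ ≟ˢ σ)
  P₃? = λ υ → P₂? υ ×-dec ¬? (υ ≟ˢ τ)
  assoc₃ : ∀ c → 1ℤ ℤ.+ (1ℤ ℤ.+ (1ℤ ℤ.+ c)) ≡ + 3 ℤ.+ c
  assoc₃ = solve-∀
  count : card P? ≡ + 3 ℤ.+ card P₃?
  count = trans (card-remove P? Pρ) (trans (cong ℤ.suc
    (trans (card-remove P₁? (Pσ , σ≢ρ)) (cong ℤ.suc (card-remove P₂? ((Pτ , τ≢ρ) , τ≢σ)))))
    (assoc₃ (card P₃?)))

card-two : (P? : Decidable P) {ρ : Subset n} → card P? ≡ + 2 → P ρ → ∃[ σ ] P σ × σ ≢ ρ
card-two P? {ρ} two Pρ with anySubset? (λ σ → P? σ ×-dec ¬? (σ ≟ˢ ρ))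
... | yes other = other
... | no ¬other = contradiction (trans (sym two) one) λ ()
  where
  one : card P? ≡ 1ℤ
  one = trans (card-remove P? Pρ) (cong ℤ.suc
    (Σˢ-zero λ σ → ▸-no (P? σ ×-dec ¬? (σ ≟ˢ ρ)) λ Pσ → ¬other (σ , Pσ)))

module Manifold (M : Complex n) (mfd : IsCombinatorial3Manifold M) where
  open IsCombinatorial3Manifold mfd

  ∣face∣≤4 : ∀ {σ} → Face M σ → ∣ σ ∣ ≤ 4
  ∣face∣≤4 = proj₂ (proj₁ pure) _

  vertex : ∀ {σ v} → Face M σ → v ∈ σ → Vertex M v
  vertex σ∈M v∈σ = down-closed M (⁅⁆⊆ v∈σ) σ∈M

  -- Passing to the link of any vertex of `σ` reverses the sign, and in that 2-sphere the sum is -1,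
  -- even when `σ - v` is empty.
  starSum-face : ∀ {σ} → Face M σ → Nonempty σ → starSum M σ ≡ 1ℤ
  starSum-face {σ} σ∈M (v , v∈σ) = trans (starSum-link M v∈M v∈σ) (cong ℤ.-_
    (eulerian (sphere-manifold (link-sphere v v∈M)) (σ - v)
      (x∉p-x v σ , down-closed M (⁅x⁆∪p-x⊆p v∈σ) σ∈M)))
    where v∈M = vertex σ∈M v∈σ

  tetraStar? : ∀ σ → Decidable (λ τ → (σ ⊆ τ × Face M τ) × ∣ τ ∣ ≡ 4)
  tetraStar? σ τ = star? M σ τ ×-dec (∣ τ ∣ ℕ.≟ 4)

  -- The star of `ρ` has alternating sum 1; `ρ` itself contributes -1 and each remaining face is a
  -- tetrahedron contributing 1.
  triangle-tetrahedra : ∀ {ρ} → Face M ρ → ∣ ρ ∣ ≡ 3 → card (tetraStar? ρ) ≡ + 2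
  triangle-tetrahedra {ρ} ρ∈M ∣ρ∣≡3 = begin
    card (tetraStar? ρ)
      ≡⟨ Σˢ-cong (λ τ → ▸-cong (tetraStar? ρ τ) (tetraStar? ρ τ) id id
           λ (_ , ∣τ∣≡4) → sym (trans (sgn-size τ) (cong (-1ℤ ℤ.^_) ∣τ∣≡4))) ⟩
    alt (tetraStar? ρ)
      ≡⟨ cancel (alt (tetraStar? ρ)) ⟩
    (alt (tetraStar? ρ) ℤ.+ -1ℤ) ℤ.+ 1ℤ
      ≡⟨ cong (λ z → (alt (tetraStar? ρ) ℤ.+ z) ℤ.+ 1ℤ) (trans
           (Σˢ-cong λ τ → ▸-cong (star? M ρ τ ×-dec ¬? (∣ τ ∣ ℕ.≟ 4)) (τ ≟ˢ ρ)
             (λ ((ρ⊆τ , τ∈M) , ∣τ∣≢4) → sym (⊆∧∣∣≤⇒≡ ρ⊆τ (subst (_ ≤_) (sym ∣ρ∣≡3)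
               (ℕ.≤-pred (ℕ.≤∧≢⇒< (∣face∣≤4 τ∈M) ∣τ∣≢4)))))
             (λ { refl → (id , ρ∈M) , λ ∣ρ∣≡4 → contradiction (trans (sym ∣ρ∣≡3) ∣ρ∣≡4) λ () })
             (λ ((ρ⊆τ , τ∈M) , ∣τ∣≢4) → trans (sgn-size τ) (cong (-1ℤ ℤ.^_)
               (ℕ.≤-antisym (ℕ.≤-pred (ℕ.≤∧≢⇒< (∣face∣≤4 τ∈M) ∣τ∣≢4))
                            (subst (_≤ _) ∣ρ∣≡3 (p⊆q⇒∣p∣≤∣q∣ ρ⊆τ))))))
           (Σˢ-δ ρ -1ℤ)) ⟨
    (alt (tetraStar? ρ) ℤ.+ alt (λ τ → star? M ρ τ ×-dec ¬? (∣ τ ∣ ℕ.≟ 4))) ℤ.+ 1ℤ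
      ≡⟨ cong (ℤ._+ 1ℤ) (alt-split (star? M ρ) (λ τ → ∣ τ ∣ ℕ.≟ 4)) ⟨
    starSum M ρ ℤ.+ 1ℤ
      ≡⟨ cong (ℤ._+ 1ℤ) (starSum-face ρ∈M (1≤∣∣⇒Nonempty (subst (1 ≤_) (sym ∣ρ∣≡3) (s≤s z≤n)))) ⟩
    + 2 ∎
    where
    open ≡-Reasoning
    cancel : ∀ z → z ≡ (z ℤ.+ -1ℤ) ℤ.+ 1ℤ
    cancel = solve-∀

  -- Opaque because the with-abstractions below would normalise the proof.
  opaque
    tetrahedron-across : ∀ {T v} → Face M T → ∣ T ∣ ≡ 4 → v ∈ T →
                         ∃[ T′ ] T - v ⊆ T′ × Face M T′ × ∣ T′ ∣ ≡ 4 × v ∉ T′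
    tetrahedron-across {T} {v} T∈M ∣T∣≡4 v∈T =
      let T′ , ((T-v⊆T′ , T′∈M) , ∣T′∣≡4) , T′≢T = other in
      T′ , (λ {x} → T-v⊆T′ {x}) , T′∈M , ∣T′∣≡4 , λ v∈T′ →
        T′≢T (sym (⊆∧∣∣≤⇒≡ (∪-lub (⁅⁆⊆ v∈T′) (λ {x} → T-v⊆T′ {x}) ∘ p⊆⁅x⁆∪p-x T v)
                           (ℕ.≤-reflexive (trans ∣T′∣≡4 (sym ∣T∣≡4)))))
      where
      ∣T-v∣≡3 : ∣ T - v ∣ ≡ 3
      ∣T-v∣≡3 = ℕ.≤-antisym (ℕ.≤-pred (subst (suc ∣ T - v ∣ ≤_) ∣T∣≡4 (x∈p⇒∣p-x∣<∣p∣ v∈T)))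
                            (ℕ.≤-pred (subst (_≤ suc ∣ T - v ∣) ∣T∣≡4 (∣p∣≤1+∣p-x∣ T v)))
      other : ∃[ T′ ] ((T - v ⊆ T′ × Face M T′) × ∣ T′ ∣ ≡ 4) × T′ ≢ T
      other = card-two (tetraStar? (T - v)) {T}
        (triangle-tetrahedra {T - v} (down-closed M (p-x⊆p v) T∈M) ∣T-v∣≡3)
        ((p-x⊆p v , T∈M) , ∣T∣≡4)

  -- Let `a` and `b` be vertices of a tetrahedron `T` off `e`. Crossing the triangles opposite `a`
  -- and `b` gives `T₁` and `T₂`: `T₁` has `b` but not `a`, and `T₂` lacks `b`, so all three differ.
  tetrahedra-around : ∀ {e} → Face M e → ∣ e ∣ ≡ 2 →
    let Tetra = λ T → (e ⊆ T × Face M T) × ∣ T ∣ ≡ 4 in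
    ∃[ T ] ∃[ T₁ ] ∃[ T₂ ] (Tetra T × Tetra T₁ × Tetra T₂) × T₁ ≢ T × T₂ ≢ T × T₂ ≢ T₁
  tetrahedra-around {e} e∈M ∣e∣≡2 with proj₂ pure e e∈M
  ... | T , T∈M , ∣T∣≡4 , e⊆T
    with ⊈⇒∃ (∣∣<⇒⊈ {p = e} {T} (subst₂ (λ k l → suc k ≤ l) (sym ∣e∣≡2) (sym ∣T∣≡4) (ℕ.n≤1+n 3)))
  ... | a , a∈T , a∉e
    with ⊈⇒∃ (∣∣<⇒⊈ {p = e} {T - a} (subst (λ k → suc k ≤ _) (sym ∣e∣≡2)
           (ℕ.≤-pred (subst (_≤ suc ∣ T - a ∣) ∣T∣≡4 (∣p∣≤1+∣p-x∣ T a)))))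
  ... | b , b∈T-a , b∉e
    with tetrahedron-across T∈M ∣T∣≡4 a∈T | tetrahedron-across T∈M ∣T∣≡4 (p-x⊆p a b∈T-a)
  ... | T₁ , T-a⊆T₁ , T₁∈M , ∣T₁∣ , a∉T₁ | T₂ , T-b⊆T₂ , T₂∈M , ∣T₂∣ , b∉T₂ =
    T , T₁ , T₂ ,
    (((e⊆T , T∈M) , ∣T∣≡4) ,
     ((T-a⊆T₁ ∘ -‿⊆ e⊆T a∉e , T₁∈M) , ∣T₁∣) ,
     ((T-b⊆T₂ ∘ -‿⊆ e⊆T b∉e , T₂∈M) , ∣T₂∣)) ,
    (λ { refl → a∉T₁ a∈T }) ,
    (λ { refl → b∉T₂ (p-x⊆p a b∈T-a) }) ,
    (λ { refl → b∉T₂ (T-a⊆T₁ b∈T-a) })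

  edge-tetrahedra : ∀ {e} → Face M e → ∣ e ∣ ≡ 2 → + 3 ℤ.≤ card (tetraStar? e)
  edge-tetrahedra {e} e∈M ∣e∣≡2 =
    let _ , _ , _ , (t , t₁ , t₂) , ≢₁ , ≢₂ , ≢₃ = tetrahedra-around e∈M ∣e∣≡2
    in card-three (tetraStar? e) t t₁ t₂ ≢₁ ≢₂ ≢₃

-- The slicing

▸-row : (a? : Dec A) {R : Pred (Subset n) 0ℓ} (b? : Decidable R) (f : Subset n → ℤ) →
        Σˢ (λ τ → (a? ×-dec b? τ) ▸ f τ) ≡ a? ▸ Σˢ (λ τ → b? τ ▸ f τ)
▸-row (yes _) b? f = refl
▸-row (no ¬a) b? f = Σˢ-zero {f = λ τ → (no ¬a ×-dec b? τ) ▸ f τ} λ _ → refl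

▸-*ˡ : (a? : Dec A) (c z : ℤ) → a? ▸ c ℤ.* z ≡ c ℤ.* (a? ▸ z)
▸-*ˡ (yes _) c z = refl
▸-*ˡ (no _)  c z = sym (ℤ.*-zeroʳ c)

▸-mono : (a? : Dec A) (b? : Dec B) → (A → B) → a? ▸ 1ℤ ℤ.≤ b? ▸ 1ℤ
▸-mono (yes a) b?      f = ℤ.≤-reflexive (sym (▸-yes b? (f a)))
▸-mono (no _)  (yes _) f = +≤+ z≤n
▸-mono (no _)  (no _)  f = ℤ.≤-refl

▸-monoʳ : (a? : Dec A) {y z : ℤ} → (A → y ℤ.≤ z) → a? ▸ y ℤ.≤ a? ▸ z
▸-monoʳ (yes a) le = le a
▸-monoʳ (no _)  le = ℤ.≤-refl

-- Toggling a point of `ρ` cancels the sum over all its subsets, of which the empty one contributes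
-- 1.
alt-subsets : {ρ : Subset n} → Nonempty ρ → alt (λ σ → (σ ⊆? ρ) ×-dec nonempty? σ) ≡ -1ℤ
alt-subsets {n} {ρ} (x , x∈ρ) = trans (+≡0⇒≡- (trans (sym (alt-split (_⊆? ρ) nonempty?)) all)) (cong ℤ.-_ empty)
  where
  all : alt (_⊆? ρ) ≡ 0ℤ
  all = alt-toggle x (_⊆? ρ) λ σ⊆ρ {y} y∈ → case y Fin.≟ x of λ where
    (yes refl) → x∈ρ
    (no y≢x)   → σ⊆ρ (∈-toggle⁻ y≢x y∈)
  empty : alt (λ σ → (σ ⊆? ρ) ×-dec ¬? (nonempty? σ)) ≡ 1ℤ
  empty = trans (Σˢ-cong λ σ → ▸-cong ((σ ⊆? ρ) ×-dec ¬? (nonempty? σ)) (σ ≟ˢ ⊥)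
      (λ (_ , empty) → Empty-unique empty)
      (λ { refl → ⊆-min ρ , λ (_ , y∈⊥) → ∉⊥ y∈⊥ })
      (λ (_ , empty) → trans (sgn-size σ)
        (cong (-1ℤ ℤ.^_) (trans (cong ∣_∣ (Empty-unique empty)) (∣⊥∣≡0 n)))))
    (Σˢ-δ (⊥ {n}) 1ℤ)

alt-size : (P? : Decidable P) (c? : Decidable Q) (k : ℕ) → (∀ {σ} → P σ → Q σ) → (∀ {σ} → Q σ → P σ) →
           (∀ {σ} → P σ → ∣ σ ∣ ≡ k) → alt P? ≡ (-1ℤ ℤ.^ k) ℤ.* card c?
alt-size P? c? k f g size = trans
  (Σˢ-cong λ σ → trans
    (▸-cong (P? σ) (c? σ) f g λ p → trans (sgn-size σ)
      (trans (cong (-1ℤ ℤ.^_) (size p)) (sym (ℤ.*-identityʳ _))))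
    (▸-*ˡ (c? σ) (-1ℤ ℤ.^ k) 1ℤ))
  (Σˢ-*ˡ (-1ℤ ℤ.^ k) (λ σ → c? σ ▸ 1ℤ))

singleton? : (W : Subset n) → Decidable (λ σ → σ ⊆ W × ∣ σ ∣ ≡ 1)
singleton? W σ = (σ ⊆? W) ×-dec (∣ σ ∣ ℕ.≟ 1)

card-singletons : (W : Subset n) → card (singleton? W) ≡ + ∣ W ∣
card-singletons []                = refl
card-singletons {suc n} (inside ∷ W)  = cong₂ ℤ._+_
  (trans (Σˢ-cong λ σ → ▸-cong (singleton? (inside ∷ W) (inside ∷ σ)) (σ ≟ˢ ⊥)
      (λ (_ , eq) → Empty-unique λ ne → contradiction (subst (1 ≤_) (ℕ.suc-injective eq) (Nonempty⇒1≤∣∣ ne)) λ ())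
      (λ { refl → s⊆s (⊆-min W) , cong suc (∣⊥∣≡0 n) }) (λ _ → refl))
    (Σˢ-δ (⊥ {n}) 1ℤ))
  (trans (Σˢ-cong λ σ → ▸-cong (singleton? (inside ∷ W) (outside ∷ σ)) (singleton? W σ)
      (λ (σ⊆W , eq) → drop-∷-⊆ σ⊆W , eq) (λ (σ⊆W , eq) → out⊆ σ⊆W , eq) (λ _ → refl))
    (card-singletons W))
card-singletons (outside ∷ W) = trans (cong₂ ℤ._+_
  (Σˢ-zero λ σ → ▸-no (singleton? (outside ∷ W) (inside ∷ σ)) {1ℤ} λ (σ⊆W , _) → case σ⊆W here of λ ())
  (trans (Σˢ-cong λ σ → ▸-cong (singleton? (outside ∷ W) (outside ∷ σ)) (singleton? W σ)
      (λ (σ⊆W , eq) → drop-∷-⊆ σ⊆W , eq) (λ (σ⊆W , eq) → out⊆ σ⊆W , eq) (λ _ → refl))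
    (card-singletons W)))
  (ℤ.+-identityˡ _)

-- Cells list their conditions in the order of the two parts; this reordering lets the argument
-- treat both choices of `i` at once.
×-opposite⁺ : (P : Fin 2 → Set) (i : Fin 2) → P i → P (opposite i) → P zero × P (suc zero)
×-opposite⁺ P zero       p q = p , q
×-opposite⁺ P (suc zero) p q = q , p

×-opposite⁻ : (P : Fin 2 → Set) (i : Fin 2) → P zero × P (suc zero) → P i × P (opposite i)
×-opposite⁻ P zero       (p , q) = p , q
×-opposite⁻ P (suc zero) (p , q) = q , p

module SlicingSide (M : Complex n) (mfd : IsCombinatorial3Manifold M)
                   (V : Fin 2 → Subset n) (part : IsPartition M V) (i : Fin 2) where
  open IsCombinatorial3Manifold mfd
  open Manifold M mfd
  open Slicing M V

  W W′ : Subset n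
  W  = V i
  W′ = V (opposite i)

  W-vertex : ∀ {v} → v ∈ W → Vertex M v
  W-vertex v∈W = ∈-vertices⁻ M (subst (_ ∈_) (proj₁ part) (side i v∈W))
    where
    side : ∀ k → V k ⊆ V zero ∪ V (suc zero)
    side zero       = p⊆p∪q (V (suc zero))
    side (suc zero) = q⊆p∪q (V zero) (V (suc zero))

  disjoint : ∀ {v} → v ∈ W → v ∉ W′
  disjoint {v} v∈W v∈W′ = ∉⊥ (subst (v ∈_) (proj₁ (proj₂ part))
    (x∈p∩q⁺ (×-opposite⁺ (λ k → v ∈ V k) i v∈W v∈W′)))

  cover : ∀ {σ v} → Face M σ → v ∈ σ → v ∉ W → v ∈ W′
  cover {v = v} σ∈M v∈σ v∉W with
    x∈p∪q⁻ (V zero) _ (subst (v ∈_) (sym (proj₁ part)) (∈-vertices⁺ M (vertex σ∈M v∈σ)))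
  ... | v∈ = other i v∉W v∈
    where
    other : ∀ k → v ∉ V k → v ∈ V zero ⊎ v ∈ V (suc zero) → v ∈ V (opposite k)
    other zero       ∉k (inj₁ ∈0) = contradiction ∈0 ∉k
    other zero       ∉k (inj₂ ∈1) = ∈1
    other (suc zero) ∉k (inj₁ ∈0) = ∈0
    other (suc zero) ∉k (inj₂ ∈1) = contradiction ∈1 ∉k

  Meets : Subset n → Subset n → Set
  Meets U σ = Nonempty (σ ∩ U)

  meets? : ∀ U → Decidable (Meets U)
  meets? U σ = nonempty? (σ ∩ U)

  ⊆W : ∀ {σ} → Face M σ → ¬ Meets W′ σ → σ ⊆ W
  ⊆W σ∈M ¬meets {v} v∈σ = decidable-stable (v ∈? W) λ v∉W →
    ¬meets (v , x∈p∩q⁺ (v∈σ , cover σ∈M v∈σ v∉W))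

  toCell : ∀ {k σ} → Face M σ → ∣ σ ∣ ≡ 2 + k → Meets W σ → Meets W′ σ → Cell k σ
  toCell σ∈M ∣σ∣ w w′ = σ∈M , ∣σ∣ , ×-opposite⁺ (λ k → Meets (V k) _) i w w′

  fromCell : ∀ {k σ} → Cell k σ → Meets W σ × Meets W′ σ
  fromCell (_ , _ , w) = ×-opposite⁻ (λ k → Meets (V k) _) i w

  ∣∩W∣+∣∩W′∣ : ∀ {σ} → Face M σ → (∣ σ ∩ W ∣) + (∣ σ ∩ W′ ∣) ≡ ∣ σ ∣
  ∣∩W∣+∣∩W′∣ {σ} σ∈M = begin
    (∣ σ ∩ W ∣) + (∣ σ ∩ W′ ∣)
      ≡⟨ ∣p∪q∣+∣p∩q∣ (σ ∩ W) (σ ∩ W′) ⟨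
    (∣ (σ ∩ W) ∪ (σ ∩ W′) ∣) + (∣ (σ ∩ W) ∩ (σ ∩ W′) ∣)
      ≡⟨ cong₂ (λ p q → (∣ p ∣) + (∣ q ∣)) union (Empty-unique inter) ⟩
    (∣ σ ∣) + (∣ ⊥ {n} ∣)
      ≡⟨ cong (λ k → (∣ σ ∣) + k) (∣⊥∣≡0 n) ⟩
    ∣ σ ∣ + 0
      ≡⟨ ℕ.+-identityʳ ∣ σ ∣ ⟩
    ∣ σ ∣ ∎
    where
    open ≡-Reasoning
    union : (σ ∩ W) ∪ (σ ∩ W′) ≡ σ
    union = ⊆-antisym (∪-lub (p∩q⊆p σ W) (p∩q⊆p σ W′)) λ {v} v∈σ → case v ∈? W of λ where
      (yes v∈W) → p⊆p∪q (σ ∩ W′) (x∈p∩q⁺ (v∈σ , v∈W))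
      (no v∉W)  → q⊆p∪q (σ ∩ W) (σ ∩ W′) (x∈p∩q⁺ (v∈σ , cover σ∈M v∈σ v∉W))
    inter : Empty ((σ ∩ W) ∩ (σ ∩ W′))
    inter (v , v∈) with x∈p∩q⁻ (σ ∩ W) _ v∈
    ... | v∈σW , v∈σW′ = disjoint (proj₂ (x∈p∩q⁻ σ W v∈σW)) (proj₂ (x∈p∩q⁻ σ W′ v∈σW′))

  -- The Euler characteristic of the slicing

  inner? : Decidable (λ σ → (Face M σ × σ ⊆ W) × Nonempty σ)
  inner? σ = (face? M σ ×-dec (σ ⊆? W)) ×-dec nonempty? σ

  touching? : Decidable (λ σ → Face M σ × Meets W σ)
  touching? σ = face? M σ ×-dec meets? W σ

  crossing? : Decidable (λ σ → (Face M σ × Meets W σ) × Meets W′ σ)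
  crossing? σ = touching? σ ×-dec meets? W′ σ

  -- Sum `sgn σ` times `sgn τ` over pairs with `σ` inner and `σ ⊆ τ`. For fixed `σ` the star
  -- contributes the factor 1; for fixed `τ` the nonempty subsets of `τ ∩ W` contribute -1.
  alt-inner≡-alt-touching : alt inner? ≡ ℤ.- alt touching?
  alt-inner≡-alt-touching = begin
    alt inner?
      ≡⟨ Σˢ-cong row ⟨
    Σˢ (λ σ → Σˢ (term σ))
      ≡⟨ Σˢ-swap term ⟩
    Σˢ (λ τ → Σˢ (λ σ → term σ τ))
      ≡⟨ Σˢ-cong column ⟩
    Σˢ (λ τ → ℤ.- (touching? τ ▸ sgn τ))
      ≡⟨ Σˢ-neg (λ τ → touching? τ ▸ sgn τ) ⟩
    ℤ.- alt touching? ∎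
    where
    open ≡-Reasoning
    term : Subset n → Subset n → ℤ
    term σ τ = (inner? σ ×-dec star? M σ τ) ▸ (sgn σ ℤ.* sgn τ)
    row : ∀ σ → Σˢ (term σ) ≡ inner? σ ▸ sgn σ
    row σ = trans (▸-row (inner? σ) (star? M σ) (λ τ → sgn σ ℤ.* sgn τ))
      (▸-cong (inner? σ) (inner? σ) id id λ ((σ∈M , _) , ne) → begin
        Σˢ (λ τ → star? M σ τ ▸ sgn σ ℤ.* sgn τ)    ≡⟨ Σˢ-cong (λ τ → ▸-*ˡ (star? M σ τ) (sgn σ) (sgn τ)) ⟩
        Σˢ (λ τ → sgn σ ℤ.* (star? M σ τ ▸ sgn τ))  ≡⟨ Σˢ-*ˡ (sgn σ) (λ τ → star? M σ τ ▸ sgn τ) ⟩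
        sgn σ ℤ.* starSum M σ                       ≡⟨ cong (sgn σ ℤ.*_) (starSum-face σ∈M ne) ⟩
        sgn σ ℤ.* 1ℤ                                ≡⟨ ℤ.*-identityʳ (sgn σ) ⟩
        sgn σ                                       ∎)
    column : ∀ τ → Σˢ (λ σ → term σ τ) ≡ ℤ.- (touching? τ ▸ sgn τ)
    column τ = begin
      Σˢ (λ σ → term σ τ)
        ≡⟨ Σˢ-cong (λ σ → ▸-cong (inner? σ ×-dec star? M σ τ) (touching? τ ×-dec sub? σ)
             (λ (((_ , σ⊆W) , (x , x∈σ)) , σ⊆τ , τ∈M) →
               (τ∈M , x , x∈p∩q⁺ (σ⊆τ x∈σ , σ⊆W x∈σ)) ,
               (λ z∈σ → x∈p∩q⁺ (σ⊆τ z∈σ , σ⊆W z∈σ)) , x , x∈σ)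
             (λ ((τ∈M , _) , σ⊆τW , ne) →
               ((down-closed M (p∩q⊆p τ W ∘ σ⊆τW) τ∈M , p∩q⊆q τ W ∘ σ⊆τW) , ne) ,
               p∩q⊆p τ W ∘ σ⊆τW , τ∈M)
             (λ _ → ℤ.*-comm (sgn σ) (sgn τ))) ⟩
      Σˢ (λ σ → (touching? τ ×-dec sub? σ) ▸ (sgn τ ℤ.* sgn σ))
        ≡⟨ ▸-row (touching? τ) sub? (λ σ → sgn τ ℤ.* sgn σ) ⟩
      touching? τ ▸ Σˢ (λ σ → sub? σ ▸ sgn τ ℤ.* sgn σ)
        ≡⟨ ▸-cong (touching? τ) (touching? τ) id id (λ (_ , meets) → begin
             Σˢ (λ σ → sub? σ ▸ sgn τ ℤ.* sgn σ)    ≡⟨ Σˢ-cong (λ σ → ▸-*ˡ (sub? σ) (sgn τ) (sgn σ)) ⟩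
             Σˢ (λ σ → sgn τ ℤ.* (sub? σ ▸ sgn σ))  ≡⟨ Σˢ-*ˡ (sgn τ) (λ σ → sub? σ ▸ sgn σ) ⟩
             sgn τ ℤ.* alt sub?                     ≡⟨ cong (sgn τ ℤ.*_) (alt-subsets meets) ⟩
             sgn τ ℤ.* -1ℤ                          ≡⟨ ℤ.*-comm (sgn τ) -1ℤ ⟩
             -1ℤ ℤ.* sgn τ                          ≡⟨ ℤ.-1*i≡-i (sgn τ) ⟩
             ℤ.- sgn τ                              ∎) ⟩
      touching? τ ▸ ℤ.- sgn τ
        ≡⟨ ▸-neg (touching? τ) (sgn τ) ⟩
      ℤ.- (touching? τ ▸ sgn τ) ∎
      where
      sub? : Decidable (λ σ → σ ⊆ τ ∩ W × Nonempty σ)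
      sub? σ = (σ ⊆? τ ∩ W) ×-dec nonempty? σ

  -- A face that meets `W` but not `W′` lies inside `W`. With the previous identity, the crossing
  -- faces sum to -2 times the inner ones.
  alt-touching : alt touching? ≡ alt crossing? ℤ.+ alt inner?
  alt-touching = trans (alt-split touching? (meets? W′)) (cong (λ z → alt crossing? ℤ.+ z)
    (alt-cong (λ σ → touching? σ ×-dec ¬? (meets? W′ σ)) inner?
      (λ {σ} ((σ∈M , (x , x∈)) , ¬w′) → (σ∈M , ⊆W σ∈M ¬w′) , x , p∩q⊆p σ W x∈)
      (λ {σ} ((σ∈M , σ⊆W) , (x , x∈σ)) → (σ∈M , x , x∈p∩q⁺ (x∈σ , σ⊆W x∈σ)) ,
        λ (y , y∈) → disjoint (σ⊆W (p∩q⊆p σ W′ y∈)) (p∩q⊆q σ W′ y∈))))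

  2≤∣crossing∣ : ∀ {σ} → Meets W σ → Meets W′ σ → 2 ≤ ∣ σ ∣
  2≤∣crossing∣ {σ} (x , x∈) (y , y∈) = 2≤∣∣ (p∩q⊆p σ W x∈) (p∩q⊆p σ W′ y∈)
    λ { refl → disjoint (p∩q⊆q σ W x∈) (p∩q⊆q σ W′ y∈) }

  -- A `k`-cell is a crossing simplex with `k + 2` vertices, so both signs agree. Crossing faces
  -- have between two and four vertices, hence all of them are counted.
  χ≡alt-crossing : χ ≡ alt crossing?
  χ≡alt-crossing = begin
    + ♯ (cell? 0) ℤ.- + ♯ (cell? 1) ℤ.+ + ♯ (cell? 2)
      ≡⟨ cong₂ ℤ._+_ (cong₂ ℤ._-_ (♯≡card (cell? 0)) (♯≡card (cell? 1))) (♯≡card (cell? 2)) ⟩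
    card (cell? 0) ℤ.- card (cell? 1) ℤ.+ card (cell? 2)
      ≡⟨ signs (card (cell? 0)) (card (cell? 1)) (card (cell? 2)) ⟩
    1ℤ ℤ.* card (cell? 0) ℤ.+ (-1ℤ ℤ.* card (cell? 1) ℤ.+ 1ℤ ℤ.* card (cell? 2))
      ≡⟨ cong₂ ℤ._+_
           (alt-size (λ σ → crossing? σ ×-dec size? 2 σ) (cell? 0) 2
             (λ (((σ∈M , w) , w′) , ∣σ∣) → toCell σ∈M ∣σ∣ w w′)
             (λ c@(σ∈M , ∣σ∣ , _) → let w , w′ = fromCell c in ((σ∈M , w) , w′) , ∣σ∣)
             proj₂)
           (cong₂ ℤ._+_
             (alt-size (λ σ → ≢2? σ ×-dec size? 3 σ) (cell? 1) 3
               (λ ((((σ∈M , w) , w′) , _) , ∣σ∣) → toCell σ∈M ∣σ∣ w w′)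
               (λ c@(σ∈M , ∣σ∣ , _) → let w , w′ = fromCell c in
                 (((σ∈M , w) , w′) , λ ≡2 → contradiction (trans (sym ∣σ∣) ≡2) λ ()) , ∣σ∣)
               proj₂)
             (alt-size (λ σ → ≢2? σ ×-dec ¬? (size? 3 σ)) (cell? 2) 4
               (λ p@((((σ∈M , w) , w′) , _) , _) → toCell σ∈M (size-4 p) w w′)
               (λ c@(σ∈M , ∣σ∣ , _) → let w , w′ = fromCell c in
                 (((σ∈M , w) , w′) , λ ≡2 → contradiction (trans (sym ∣σ∣) ≡2) λ ()) ,
                 λ ≡3 → contradiction (trans (sym ∣σ∣) ≡3) λ ())
               size-4)) ⟨
    alt (λ σ → crossing? σ ×-dec size? 2 σ) ℤ.+
      (alt (λ σ → ≢2? σ ×-dec size? 3 σ) ℤ.+ alt (λ σ → ≢2? σ ×-dec ¬? (size? 3 σ)))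
      ≡⟨ cong (λ z → alt (λ σ → crossing? σ ×-dec size? 2 σ) ℤ.+ z) (alt-split ≢2? (size? 3)) ⟨
    alt (λ σ → crossing? σ ×-dec size? 2 σ) ℤ.+ alt ≢2?
      ≡⟨ alt-split crossing? (size? 2) ⟨
    alt crossing? ∎
    where
    open ≡-Reasoning
    size? : ∀ k → Decidable (λ (σ : Subset n) → ∣ σ ∣ ≡ k)
    size? k σ = ∣ σ ∣ ℕ.≟ k
    ≢2? : Decidable (λ σ → ((Face M σ × Meets W σ) × Meets W′ σ) × ¬ ∣ σ ∣ ≡ 2)
    ≢2? σ = crossing? σ ×-dec ¬? (size? 2 σ)
    size-4 : ∀ {σ} → (((Face M σ × Meets W σ) × Meets W′ σ) × ¬ ∣ σ ∣ ≡ 2) × ¬ ∣ σ ∣ ≡ 3 → ∣ σ ∣ ≡ 4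
    size-4 ((((σ∈M , w) , w′) , ≢2) , ≢3) = ℕ.≤-antisym (∣face∣≤4 σ∈M)
      (ℕ.≤∧≢⇒< (ℕ.≤∧≢⇒< (2≤∣crossing∣ w w′) (≢2 ∘ sym)) (≢3 ∘ sym))
    signs : ∀ a b c → (a ℤ.- b) ℤ.+ c ≡ 1ℤ ℤ.* a ℤ.+ (-1ℤ ℤ.* b ℤ.+ 1ℤ ℤ.* c)
    signs = solve-∀

  -- The bound when `span W` is a graph

  edge? : Decidable (λ σ → (Face M σ × σ ⊆ W) × ∣ σ ∣ ≡ 2)
  edge? σ = (face? M σ ×-dec (σ ⊆? W)) ×-dec (∣ σ ∣ ℕ.≟ 2)

  module OneDimensional (dim : ∀ {σ} → Face M σ → σ ⊆ W → ∣ σ ∣ ≤ 2) where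

    -- This is minus the Euler characteristic of the graph; every label in `W` is an actual vertex
    -- because the parts make up the vertex set.
    alt-inner : alt inner? ≡ card edge? ℤ.- + ∣ W ∣
    alt-inner = begin
      alt inner?
        ≡⟨ alt-split inner? (λ σ → ∣ σ ∣ ℕ.≟ 2) ⟩
      alt (λ σ → inner? σ ×-dec (∣ σ ∣ ℕ.≟ 2)) ℤ.+ alt (λ σ → inner? σ ×-dec ¬? (∣ σ ∣ ℕ.≟ 2))
        ≡⟨ cong₂ ℤ._+_
             (alt-size (λ σ → inner? σ ×-dec (∣ σ ∣ ℕ.≟ 2)) edge? 2
               (λ ((σ∈ , _) , ∣σ∣) → σ∈ , ∣σ∣)
               (λ {σ} (σ∈ , ∣σ∣) → (σ∈ , 1≤∣∣⇒Nonempty {p = σ} (subst (1 ≤_) (sym ∣σ∣) (s≤s z≤n))) , ∣σ∣)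
               proj₂)
             (alt-size (λ σ → inner? σ ×-dec ¬? (∣ σ ∣ ℕ.≟ 2)) (singleton? W) 1
               (λ p@(((_ , σ⊆W) , _) , _) → (λ {x} → σ⊆W {x}) , size-1 p)
               (λ {σ} (σ⊆W , ∣σ∣) → singleton-inner σ⊆W ∣σ∣)
               size-1) ⟩
      1ℤ ℤ.* card edge? ℤ.+ -1ℤ ℤ.* card (singleton? W)
        ≡⟨ cong₂ ℤ._+_ (ℤ.*-identityˡ (card edge?))
             (trans (ℤ.-1*i≡-i (card (singleton? W))) (cong ℤ.-_ (card-singletons W))) ⟩
      card edge? ℤ.- + ∣ W ∣ ∎
      where
      open ≡-Reasoning
      size-1 : ∀ {σ} → ((Face M σ × σ ⊆ W) × Nonempty σ) × ¬ ∣ σ ∣ ≡ 2 → ∣ σ ∣ ≡ 1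
      size-1 (((σ∈M , σ⊆W) , ne) , ≢2) =
        ℕ.≤-antisym (ℕ.≤-pred (ℕ.≤∧≢⇒< (dim σ∈M σ⊆W) ≢2)) (Nonempty⇒1≤∣∣ ne)
      singleton-inner : ∀ {σ} → σ ⊆ W → ∣ σ ∣ ≡ 1 →
                        ((Face M σ × σ ⊆ W) × Nonempty σ) × ¬ ∣ σ ∣ ≡ 2
      singleton-inner {σ} σ⊆W ∣σ∣ =
        let x , x∈σ = 1≤∣∣⇒Nonempty {p = σ} (ℕ.≤-reflexive (sym ∣σ∣))
            ⁅x⁆≡σ = ⊆∧∣∣≤⇒≡ (⁅⁆⊆ x∈σ) (ℕ.≤-reflexive (trans ∣σ∣ (sym (∣⁅x⁆∣≡1 x))))
        in ((subst (Face M) ⁅x⁆≡σ (W-vertex (σ⊆W x∈σ)) , σ⊆W) , x , x∈σ) ,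
           λ ≡2 → contradiction (trans (sym ∣σ∣) ≡2) λ ()

    -- `τ ∩ W` is a face inside `W` containing `e`, so the dimension bound makes it equal to `e`.
    -- Thus `τ` determines `e`.
    tetra-quadrilateral : ∀ {e τ} → (Face M e × e ⊆ W) × ∣ e ∣ ≡ 2 → (e ⊆ τ × Face M τ) × ∣ τ ∣ ≡ 4 →
                          e ≡ τ ∩ W × Quadrilateral τ
    tetra-quadrilateral {e} {τ} ((e∈M , e⊆W) , ∣e∣≡2) ((e⊆τ , τ∈M) , ∣τ∣≡4) =
      e≡τ∩W ,
      toCell τ∈M ∣τ∣≡4 (nonempty W ∣τ∩W∣≡2) (nonempty W′ ∣τ∩W′∣≡2) ,
      ×-opposite⁺ (λ k → ∣ τ ∩ V k ∣ ≡ 2) i ∣τ∩W∣≡2 ∣τ∩W′∣≡2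
      where
      e≡τ∩W : e ≡ τ ∩ W
      e≡τ∩W = ⊆∧∣∣≤⇒≡ (λ x∈e → x∈p∩q⁺ (e⊆τ x∈e , e⊆W x∈e))
        (subst (_ ≤_) (sym ∣e∣≡2) (dim (down-closed M (p∩q⊆p τ W) τ∈M) (p∩q⊆q τ W)))
      ∣τ∩W∣≡2 : ∣ τ ∩ W ∣ ≡ 2
      ∣τ∩W∣≡2 = trans (cong ∣_∣ (sym e≡τ∩W)) ∣e∣≡2
      ∣τ∩W′∣≡2 : ∣ τ ∩ W′ ∣ ≡ 2
      ∣τ∩W′∣≡2 = ℕ.+-cancelˡ-≡ 2 _ _
        (trans (cong (_+ ∣ τ ∩ W′ ∣) (sym ∣τ∩W∣≡2)) (trans (∣∩W∣+∣∩W′∣ τ∈M) ∣τ∣≡4))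
      nonempty : ∀ U → ∣ τ ∩ U ∣ ≡ 2 → Meets U τ
      nonempty U eq = 1≤∣∣⇒Nonempty (subst (1 ≤_) (sym eq) (s≤s z≤n))

    -- Double counting of pairs of an edge in `W` and a tetrahedron around it: at least three for
    -- each edge, at most one for each quadrilateral.
    3*edges≤quadrilaterals : + 3 ℤ.* card edge? ℤ.≤ card quadrilateral?
    3*edges≤quadrilaterals = begin
      + 3 ℤ.* card edge?
        ≡⟨ Σˢ-*ˡ (+ 3) (λ e → edge? e ▸ 1ℤ) ⟨
      Σˢ (λ e → + 3 ℤ.* (edge? e ▸ 1ℤ))
        ≡⟨ Σˢ-cong (λ e → ▸-*ˡ (edge? e) (+ 3) 1ℤ) ⟨
      Σˢ (λ e → edge? e ▸ + 3)
        ≤⟨ Σˢ-mono (λ e → ▸-monoʳ (edge? e) λ ((e∈M , _) , ∣e∣≡2) → edge-tetrahedra e∈M ∣e∣≡2) ⟩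
      Σˢ (λ e → edge? e ▸ card (tetraStar? e))
        ≡⟨ Σˢ-cong (λ e → ▸-row (edge? e) (tetraStar? e) (λ _ → 1ℤ)) ⟨
      Σˢ (λ e → Σˢ (λ τ → (edge? e ×-dec tetraStar? e τ) ▸ 1ℤ))
        ≤⟨ Σˢ-mono (λ e → Σˢ-mono (λ τ →
             ▸-mono (edge? e ×-dec tetraStar? e τ) (quadrilateral? τ ×-dec (e ≟ˢ τ ∩ W))
               λ (edge , tetra) → let eq , quad = tetra-quadrilateral edge tetra in quad , eq)) ⟩
      Σˢ (λ e → Σˢ (λ τ → (quadrilateral? τ ×-dec (e ≟ˢ τ ∩ W)) ▸ 1ℤ))
        ≡⟨ Σˢ-swap (λ e τ → (quadrilateral? τ ×-dec (e ≟ˢ τ ∩ W)) ▸ 1ℤ) ⟩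
      Σˢ (λ τ → Σˢ (λ e → (quadrilateral? τ ×-dec (e ≟ˢ τ ∩ W)) ▸ 1ℤ))
        ≡⟨ Σˢ-cong (λ τ → trans (▸-row (quadrilateral? τ) (_≟ˢ τ ∩ W) (λ _ → 1ℤ))
             (▸-cong (quadrilateral? τ) (quadrilateral? τ) id id λ _ → Σˢ-δ (τ ∩ W) 1ℤ)) ⟩
      card quadrilateral? ∎
      where open ℤ.≤-Reasoning

    1+edges≡∣W∣+g : ∀ {g} → HasGenus g → suc (♯ edge?) ≡ ∣ W ∣ + g
    1+edges≡∣W∣+g {g} genus = ℤ.+-injective (ℤ.*-cancelˡ-≡ (+ 2) _ _ (begin
      -- The right side isolates `χ + 2(E - N)`, which vanishes by the alternating sums, and
      -- `2 - χ`, which is `2g`.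
      + 2 ℤ.* (1ℤ ℤ.+ E)                           ≡⟨ expand E N χ ⟩
      (χ ℤ.+ ((E ℤ.- N) ℤ.+ (E ℤ.- N))) ℤ.+ (+ 2 ℤ.- χ) ℤ.+ + 2 ℤ.* N
        ≡⟨ cong₂ (λ y z → y ℤ.+ z ℤ.+ + 2 ℤ.* N) χ-edges
             (trans (cong (λ z → + 2 ℤ.- z) genus) (double (+ (2 * g)))) ⟩
      0ℤ ℤ.+ + (2 * g) ℤ.+ + 2 ℤ.* N
        ≡⟨ cong (λ z → 0ℤ ℤ.+ z ℤ.+ + 2 ℤ.* N) (ℤ.pos-* 2 g) ⟩
      0ℤ ℤ.+ + 2 ℤ.* + g ℤ.+ + 2 ℤ.* N             ≡⟨ collect (+ g) N ⟩
      + 2 ℤ.* (N ℤ.+ + g)                          ∎))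
      where
      open ≡-Reasoning
      E N : ℤ
      E = + ♯ edge?
      N = + ∣ W ∣
      expand : ∀ E N χ → + 2 ℤ.* (1ℤ ℤ.+ E) ≡
               (χ ℤ.+ ((E ℤ.- N) ℤ.+ (E ℤ.- N))) ℤ.+ (+ 2 ℤ.- χ) ℤ.+ + 2 ℤ.* N
      expand = solve-∀
      double : ∀ z → + 2 ℤ.- (+ 2 ℤ.- z) ≡ z
      double = solve-∀
      collect : ∀ g N → 0ℤ ℤ.+ + 2 ℤ.* g ℤ.+ + 2 ℤ.* N ≡ + 2 ℤ.* (N ℤ.+ g)
      collect = solve-∀
      inner : alt inner? ≡ E ℤ.- N
      inner = trans alt-inner (cong (ℤ._- N) (sym (♯≡card edge?)))
      rotate : ∀ x y → x ℤ.+ (y ℤ.+ y) ≡ y ℤ.+ (x ℤ.+ y)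
      rotate = solve-∀
      χ-edges : χ ℤ.+ ((E ℤ.- N) ℤ.+ (E ℤ.- N)) ≡ 0ℤ
      χ-edges = begin
        χ ℤ.+ ((E ℤ.- N) ℤ.+ (E ℤ.- N))          ≡⟨ cong₂ (λ x y → x ℤ.+ (y ℤ.+ y)) χ≡alt-crossing (sym inner) ⟩
        alt crossing? ℤ.+ (alt inner? ℤ.+ alt inner?)    ≡⟨ rotate (alt crossing?) (alt inner?) ⟩
        alt inner? ℤ.+ (alt crossing? ℤ.+ alt inner?)    ≡⟨ cong₂ ℤ._+_ alt-inner≡-alt-touching (sym alt-touching) ⟩
        ℤ.- alt touching? ℤ.+ alt touching?      ≡⟨ ℤ.+-inverseˡ (alt touching?) ⟩
        0ℤ                                       ∎

    quadrilateral-bound : ∀ {g} → HasGenus g → quadrilaterals ≥ 3 * (∣ W ∣ + g ∸ 1)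
    -- Since `∣ W ∣ + g` is a successor, the truncated subtraction gives exactly the number of
    -- edges.
    quadrilateral-bound {g} genus = subst (λ k → 3 * (k ∸ 1) ≤ quadrilaterals) (1+edges≡∣W∣+g genus)
      (ℤ.drop‿+≤+ (subst₂ ℤ._≤_
        (trans (cong (λ z → + 3 ℤ.* z) (sym (♯≡card edge?))) (sym (ℤ.pos-* 3 (♯ edge?))))
        (sym (♯≡card quadrilateral?)) 3*edges≤quadrilaterals))

  -- Slicings all of whose facets are quadrilaterals

  module AllQuads (connected : IsConnected M) (allQuads : AllQuadrilaterals) where

    -- If `τ` met `W′`, a tetrahedron over it would be a quadrilateral cell with exactly two
    -- vertices in `W`, yet it contains the three or more of `σ`.
    fat-face : ∀ {σ τ} → Face M σ → σ ⊆ W → 3 ≤ ∣ σ ∣ → Face M τ → σ ⊆ τ → τ ⊆ W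
    fat-face {σ} {τ} σ∈M σ⊆W 3≤∣σ∣ τ∈M σ⊆τ = ⊆W τ∈M λ (y , y∈) →
      let T , T∈M , ∣T∣≡4 , τ⊆T = proj₂ pure τ τ∈M
          σ⊆T∩W : σ ⊆ T ∩ W
          σ⊆T∩W = λ x∈σ → x∈p∩q⁺ (τ⊆T (σ⊆τ x∈σ) , σ⊆W x∈σ)
          x , x∈σ = 1≤∣∣⇒Nonempty {p = σ} (ℕ.≤-trans (s≤s z≤n) 3≤∣σ∣)
          _ , sizes = allQuads (toCell T∈M ∣T∣≡4 (x , σ⊆T∩W x∈σ)
            (y , x∈p∩q⁺ (τ⊆T (p∩q⊆p τ W′ y∈) , p∩q⊆q τ W′ y∈)))
          ∣T∩W∣≡2 , _ = ×-opposite⁻ (λ k → ∣ T ∩ V k ∣ ≡ 2) i sizes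
      in contradiction (subst (3 ≤_) ∣T∩W∣≡2 (ℕ.≤-trans 3≤∣σ∣ (p⊆q⇒∣p∣≤∣q∣ σ⊆T∩W))) λ { (s≤s (s≤s ())) }

    -- Consecutive link facets share an edge `ρ`; coned with `v` it becomes a triangle in `W`, to
    -- which `fat-face` applies.
    spread-link : ∀ {v t t′} (v∈M : Vertex M v) → Star (Adj 2 (link M v v∈M)) t t′ →
                  ⁅ v ⁆ ∪ t ⊆ W → ⁅ v ⁆ ∪ t′ ⊆ W
    spread-link v∈M ε vt⊆W = vt⊆W
    spread-link {v} v∈M (_◅_ {j = u} (((v∉t , vt∈M) , _) , ((_ , vu∈M) , _) ,
                              ρ , ρ⊆t , ρ⊆u , 2≤∣ρ∣) path) vt⊆W =
      spread-link v∈M path (fat-face (down-closed M vρ⊆vt vt∈M) (vt⊆W ∘ vρ⊆vt)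
        (ℕ.≤-trans (s≤s 2≤∣ρ∣) (∣⁅x⁆∪p∣ v (v∉t ∘ ρ⊆t))) vu∈M (∪-monoʳ-⊆ ⁅ v ⁆ ρ⊆u))
      where
      vρ⊆vt : ⁅ v ⁆ ∪ ρ ⊆ _
      vρ⊆vt = ∪-monoʳ-⊆ ⁅ v ⁆ ρ⊆t

    spread-star : ∀ {v T T′} → Face M T → ∣ T ∣ ≡ 4 → Face M T′ → ∣ T′ ∣ ≡ 4 → v ∈ T → v ∈ T′ →
                  T ⊆ W → T′ ⊆ W
    spread-star {v} {T} {T′} T∈M ∣T∣≡4 T′∈M ∣T′∣≡4 v∈T v∈T′ T⊆W =
      spread-link v∈M (stronglyConnected (sphere-manifold (link-sphere v v∈M))
        (facet T∈M ∣T∣≡4 v∈T) (facet T′∈M ∣T′∣≡4 v∈T′)) (T⊆W ∘ ⁅x⁆∪p-x⊆p v∈T) ∘ p⊆⁅x⁆∪p-x T′ v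
      where
      v∈M = vertex T∈M v∈T
      facet : ∀ {σ} → Face M σ → ∣ σ ∣ ≡ 4 → v ∈ σ → Facet 2 (link M v v∈M) (σ - v)
      facet {σ} σ∈M ∣σ∣≡4 v∈σ = (x∉p-x v σ , down-closed M (⁅x⁆∪p-x⊆p v∈σ) σ∈M) ,
        ℕ.≤-pred (subst (_≤ suc ∣ σ - v ∣) ∣σ∣≡4 (∣p∣≤1+∣p-x∣ σ v))

    -- The walk carries along a tetrahedron in `W` through the current vertex. A tetrahedron over
    -- the next edge shares that vertex with it, so `spread-star` puts it into `W` as well.
    spread : ∀ {v w T} → Star (λ x y → Face M (⁅ x ⁆ ∪ ⁅ y ⁆)) v w →
             Face M T → ∣ T ∣ ≡ 4 → v ∈ T → T ⊆ W → w ∈ W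
    spread ε T∈M ∣T∣≡4 v∈T T⊆W = T⊆W v∈T
    spread {v} (_◅_ {j = u} vu∈M path) T∈M ∣T∣≡4 v∈T T⊆W =
      let T′ , T′∈M , ∣T′∣≡4 , vu⊆T′ = proj₂ pure (⁅ v ⁆ ∪ ⁅ u ⁆) vu∈M
      in spread path T′∈M ∣T′∣≡4 (vu⊆T′ (q⊆p∪q ⁅ v ⁆ ⁅ u ⁆ (x∈⁅x⁆ u)))
           (spread-star T∈M ∣T∣≡4 T′∈M ∣T′∣≡4 v∈T (vu⊆T′ (p⊆p∪q ⁅ u ⁆ (x∈⁅x⁆ v))) T⊆W)

    one-dimensional : ∀ {w σ} → w ∈ W′ → Vertex M w → Face M σ → σ ⊆ W → ∣ σ ∣ ≤ 2
    one-dimensional {w} {σ} w∈W′ w∈M σ∈M σ⊆W = ℕ.≮⇒≥ λ 3≤∣σ∣ →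
      let T , T∈M , ∣T∣≡4 , σ⊆T = proj₂ pure σ σ∈M
          x , x∈σ = 1≤∣∣⇒Nonempty {p = σ} (ℕ.≤-trans (s≤s z≤n) 3≤∣σ∣)
      in disjoint (spread (proj₂ connected (vertex σ∈M x∈σ) w∈M) T∈M ∣T∣≡4 (σ⊆T x∈σ)
           (fat-face σ∈M σ⊆W 3≤∣σ∣ T∈M σ⊆T)) w∈W′

    -- The crossing edge supplied by `Connected` lies in a tetrahedron, which meets `W` in exactly
    -- two vertices; these form the edge that dimension 1 requires.
    span-dimension : Connected → HasDimension (span W M) 1
    span-dimension ((σ , cell@(σ∈M , _)) , _) =
      let (x , x∈) , (y , y∈) = fromCell cell
          T , T∈M , ∣T∣≡4 , σ⊆T = proj₂ pure σ σ∈M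
          _ , sizes = allQuads (toCell T∈M ∣T∣≡4
            (x , x∈p∩q⁺ (σ⊆T (p∩q⊆p σ W x∈) , p∩q⊆q σ W x∈))
            (y , x∈p∩q⁺ (σ⊆T (p∩q⊆p σ W′ y∈) , p∩q⊆q σ W′ y∈)))
      in (T ∩ W , (down-closed M (p∩q⊆p T W) T∈M , p∩q⊆q T W) ,
          proj₁ (×-opposite⁻ (λ k → ∣ T ∩ V k ∣ ≡ 2) i sizes)) ,
         λ τ (τ∈M , τ⊆W) → one-dimensional (p∩q⊆q σ W′ y∈) (vertex σ∈M (p∩q⊆p σ W′ y∈)) τ∈M τ⊆W

theorem4p4 : ∀ {N : ℕ} (M : Complex N) (V : Fin 2 → Subset N) (g : ℕ) →
    IsCombinatorial3Manifold M →
    IsPartition M V →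
    Slicing.Connected M V →
    Slicing.HasGenus M V g →
    (∀ i → HasDimension (span (V i) M) 1 →
    Slicing.quadrilaterals M V ≥ 3 * (∣ V i ∣ + g ∸ 1))
    ×
    (IsConnected M → Slicing.AllQuadrilaterals M V →
    ∀ i → HasDimension (span (V i) M) 1 ×
    Slicing.quadrilaterals M V ≥ 3 * (∣ V i ∣ + g ∸ 1))
theorem4p4 M V g mfd part conn genus = bound , λ connected allQuads i →
  let dim = SlicingSide.AllQuads.span-dimension M mfd V part i connected allQuads conn
  in dim , bound i dim
  where
  bound : ∀ i → HasDimension (span (V i) M) 1 → Slicing.quadrilaterals M V ≥ 3 * (∣ V i ∣ + g ∸ 1)
  bound i (_ , dim) = SlicingSide.OneDimensional.quadrilateral-bound M mfd V part i
    (λ σ∈M σ⊆W → dim _ (σ∈M , σ⊆W)) genus
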